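{- If $P$ is an equable polygon with vertices in $\mathbb{Z}[\omega]$, then each side length of $P$ is of the form $\sqrt3\,n$ for some positive integer $n$.
   Context: A planar polygon is equable if its perimeter equals its area. The Eisenstein lattice is $\mathbb{Z}[\omega]\subset\mathbb{C}$, where $\omega=-\frac12+i\frac{\sqrt3}{2}$. -}

module Defs where

open import Data.Bool.Base using (if_then_else_)
open import Data.Fin.Base using (Fin; toℕ)
open import Data.Integer.Base using (ℤ; +_)
import Data.Integer.Base as ℤ
import Data.Integer.Solver as ℤ-Solver
open import Data.Nat.Base as ℕ using (ℕ; zero; suc)
open import Data.Nat.DivMod using (_mod_)
import Data.Nat.Properties as ℕₚ
open import Data.Product using (∃-syntax; _×_; _,_)
open import Data.Rational.Base as ℚ using (ℚ; 0ℚ; 1ℚ; ½)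
import Data.Rational.Properties as ℚₚ
import Data.Rational.Solver as ℚ-Solver
import Data.Rational.Unnormalised.Base as ℚᵘ
import Data.Rational.Unnormalised.Properties as ℚᵘₚ
open import Data.Sum.Base using (inj₁; inj₂)
import Data.Vec.Functional as Vector
open import Relation.Binary.PropositionalEquality
  using (_≡_; refl; sym; trans; cong; cong₂; subst; subst₂)
open import Relation.Nullary using (yes; no; contradiction)
open import Relation.Nullary.Decidable using (⌊_⌋)

module ℚ-Lemmas where

  open ℚ-Solver.+-*-Solver using (solve; _:+_; _:*_; _:-_; :-_; con; _:=_)
  open ℤ-Solver.+-*-Solver using ()
    renaming (solve to ℤ-solve; con to ℤ-con; _:+_ to _ℤ:+_; _:*_ to _ℤ:*_; _:=_ to _ℤ:=_)

  p≤∣p∣ : ∀ p → p ℚ.≤ ℚ.∣ p ∣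
  p≤∣p∣ p with ℚₚ.≤-total 0ℚ p
  ... | inj₁ 0≤p = ℚₚ.≤-reflexive (sym (ℚₚ.0≤p⇒∣p∣≡p 0≤p))
  ... | inj₂ p≤0 = ℚₚ.≤-trans p≤0 (ℚₚ.0≤∣p∣ p)

  ∣p-q∣≡∣q-p∣ : ∀ p q → ℚ.∣ p ℚ.- q ∣ ≡ ℚ.∣ q ℚ.- p ∣
  ∣p-q∣≡∣q-p∣ p q = trans (sym (ℚₚ.∣-p∣≡∣p∣ (p ℚ.- q)))
    (cong ℚ.∣_∣ (solve 2 (λ a b → :- (a :- b) := b :- a) refl p q))

  ∣p∣<r : ∀ {p r} → p ℚ.< r → ℚ.- p ℚ.< r → ℚ.∣ p ∣ ℚ.< r
  ∣p∣<r {p} p<r -p<r with ℚₚ.∣p∣≡p∨∣p∣≡-p p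
  ... | inj₁ eq = subst (ℚ._< _) (sym eq) p<r
  ... | inj₂ eq = subst (ℚ._< _) (sym eq) -p<r

  p-q<r⇒p<q+r : ∀ p q r → p ℚ.- q ℚ.< r → p ℚ.< q ℚ.+ r
  p-q<r⇒p<q+r p q r lt = subst (ℚ._< q ℚ.+ r)
    (solve 2 (λ a b → b :+ (a :- b) := a) refl p q) (ℚₚ.+-monoʳ-< q lt)

  p<q+r⇒p-q<r : ∀ p q r → p ℚ.< q ℚ.+ r → p ℚ.- q ℚ.< r
  p<q+r⇒p-q<r p q r lt = subst (p ℚ.- q ℚ.<_)
    (solve 2 (λ b c → (b :+ c) :- b := c) refl q r)
    (ℚₚ.+-monoˡ-< (ℚ.- q) lt)

  *-mono-≤ : ∀ {p q r s} → 0ℚ ℚ.≤ q → 0ℚ ℚ.≤ r →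
             p ℚ.≤ q → r ℚ.≤ s → p ℚ.* r ℚ.≤ q ℚ.* s
  *-mono-≤ {p} {q} {r} {s} 0≤q 0≤r p≤q r≤s = ℚₚ.≤-trans
    (ℚₚ.*-monoʳ-≤-nonNeg r {{ℚ.nonNegative 0≤r}} p≤q)
    (ℚₚ.*-monoˡ-≤-nonNeg q {{ℚ.nonNegative 0≤q}} r≤s)

  *-pos : ∀ {p q} → 0ℚ ℚ.< p → 0ℚ ℚ.< q → 0ℚ ℚ.< p ℚ.* q
  *-pos {p} {q} 0<p 0<q = subst (ℚ._< p ℚ.* q) (ℚₚ.*-zeroʳ p)
    (ℚₚ.*-monoʳ-<-pos p {{ℚ.positive 0<p}} 0<q)

  *-nonNeg : ∀ {p q} → 0ℚ ℚ.≤ p → 0ℚ ℚ.≤ q → 0ℚ ℚ.≤ p ℚ.* q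
  *-nonNeg {p} {q} 0≤p 0≤q = subst (ℚ._≤ p ℚ.* q) (ℚₚ.*-zeroʳ p)
    (ℚₚ.*-monoˡ-≤-nonNeg p {{ℚ.nonNegative 0≤p}} 0≤q)

  +-nonNeg : ∀ {p q} → 0ℚ ℚ.≤ p → 0ℚ ℚ.≤ q → 0ℚ ℚ.≤ p ℚ.+ q
  +-nonNeg = ℚₚ.+-mono-≤ {0ℚ} {_} {0ℚ}

  0<½ : 0ℚ ℚ.< ½
  0<½ = ℚ.*<* (ℤ.+<+ (ℕ.s≤s ℕ.z≤n))

  0<1 : 0ℚ ℚ.< 1ℚ
  0<1 = ℚ.*<* (ℤ.+<+ (ℕ.s≤s ℕ.z≤n))

  ½+½ : ∀ p → ½ ℚ.* p ℚ.+ ½ ℚ.* p ≡ p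
  ½+½ = solve 1 (λ a → con ½ :* a :+ con ½ :* a := a) refl

  0<½* : ∀ {ε} → 0ℚ ℚ.< ε → 0ℚ ℚ.< ½ ℚ.* ε
  0<½* = *-pos 0<½

  divide : ∀ (ε B : ℚ) → 0ℚ ℚ.< ε → 0ℚ ℚ.< B → ∃[ δ ] (0ℚ ℚ.< δ × B ℚ.* δ ≡ ε)
  divide ε B 0<ε 0<B = ε ℚ.* B⁻¹ , *-pos 0<ε 0<B⁻¹ , eq
    where
    instance
      B-pos : ℚ.Positive B
      B-pos = ℚ.positive 0<B
      B-nonZero : ℚ.NonZero B
      B-nonZero = ℚₚ.pos⇒nonZero B
    B⁻¹ : ℚ
    B⁻¹ = ℚ.1/ B
    0<B⁻¹ : 0ℚ ℚ.< B⁻¹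
    0<B⁻¹ = ℚₚ.positive⁻¹ B⁻¹ {{ℚₚ.1/pos⇒pos B}}
    eq : B ℚ.* (ε ℚ.* B⁻¹) ≡ ε
    eq = trans (solve 3 (λ b e c → b :* (e :* c) := e :* (b :* c)) refl B ε B⁻¹)
      (trans (cong (ε ℚ.*_) (ℚₚ.*-inverseʳ B)) (ℚₚ.*-identityʳ ε))

  nat : ℕ → ℚ
  nat zero    = 0ℚ
  nat (suc n) = 1ℚ ℚ.+ nat n

  nat-mono : ∀ {m n} → m ℕ.≤ n → nat m ℚ.≤ nat n
  nat-mono {n = zero}  ℕ.z≤n = ℚₚ.≤-refl
  nat-mono {n = suc n} ℕ.z≤n =
    +-nonNeg (ℚₚ.<⇒≤ 0<1) (nat-mono {zero} {n} ℕ.z≤n)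
  nat-mono (ℕ.s≤s m≤n) = ℚₚ.+-monoʳ-≤ 1ℚ (nat-mono m≤n)

  toℚᵘ-nat : ∀ n → ℚ.toℚᵘ (nat n) ℚᵘ.≃ ℚᵘ.mkℚᵘ (+ n) 0
  toℚᵘ-nat zero    = ℚᵘ.*≡* refl
  toℚᵘ-nat (suc n) = ℚᵘₚ.≃-trans (ℚₚ.toℚᵘ-homo-+ 1ℚ (nat n))
    (ℚᵘₚ.≃-trans (ℚᵘₚ.+-congʳ ℚᵘ.1ℚᵘ (toℚᵘ-nat n)) (ℚᵘ.*≡*
      (ℤ-solve 1 (λ a → (ℤ-con (+ 1) ℤ:* ℤ-con (+ 1) ℤ:+ a ℤ:* ℤ-con (+ 1)) ℤ:* ℤ-con (+ 1)
                   ℤ:= (ℤ-con (+ 1) ℤ:+ a) ℤ:* ℤ-con (+ 1)) refl (+ n))))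

  archimedean : ∀ p → ∃[ n ] p ℚ.≤ nat n
  archimedean p@(ℚ.mkℚ a d _) = ℤ.∣ a ∣ , ℚₚ.toℚᵘ-cancel-≤
    (ℚᵘₚ.≤-respʳ-≃ (ℚᵘₚ.≃-sym (toℚᵘ-nat ℤ.∣ a ∣)) (ℚᵘ.*≤* (bound a)))
    where
    bound : ∀ a → a ℤ.* + 1 ℤ.≤ + ℤ.∣ a ∣ ℤ.* + suc d
    bound (+ zero)    = ℤ.+≤+ ℕ.z≤n
    bound (+ suc n)   = ℤ.+≤+ (ℕₚ.*-monoʳ-≤ (suc n) (ℕ.s≤s ℕ.z≤n))
    bound ℤ.-[1+ n ]  = ℤ.-≤+

open ℚ-Lemmas

Eventually : (ℕ → Set) → Set
Eventually P = ∃[ N ] (∀ n → N ℕ.≤ n → P n)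

IsCauchy : (ℕ → ℚ) → Set
IsCauchy x = ∀ ε → 0ℚ ℚ.< ε →
  ∃[ N ] (∀ m n → N ℕ.≤ m → N ℕ.≤ n → ℚ.∣ x m ℚ.- x n ∣ ℚ.< ε)

-- Real numbers as Cauchy sequences of rationals, up to _≃_ below; no modulus
-- of convergence is prescribed, so that operations can be defined termwise.
record ℝ : Set where
  constructor mkℝ
  field
    seq    : ℕ → ℚ
    cauchy : IsCauchy seq

open ℝ public

infix 4 _≃_ _≤_ _<_

-- A record rather than a function, so that x and y can be inferred from a
-- proof of x ≃ y.
record _≃_ (x y : ℝ) : Set where
  constructor mk≃
  field
    close : ∀ ε → 0ℚ ℚ.< ε →
      Eventually λ n → ℚ.∣ seq x n ℚ.- seq y n ∣ ℚ.< ε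

_≤_ : ℝ → ℝ → Set
x ≤ y = ∀ ε → 0ℚ ℚ.< ε → Eventually λ n → seq x n ℚ.< seq y n ℚ.+ ε

_<_ : ℝ → ℝ → Set
x < y = ∃[ ε ] (0ℚ ℚ.< ε × Eventually λ n → seq x n ℚ.+ ε ℚ.< seq y n)

module CauchyLemmas where
  open ℚ-Solver.+-*-Solver using (solve; _:+_; _:*_; _:-_; :-_; _:=_)

  abstract
    oneSided : ∀ (x : ℕ → ℚ) →
      (∀ ε → 0ℚ ℚ.< ε → ∃[ N ] (∀ m n → N ℕ.≤ m → N ℕ.≤ n → x m ℚ.- x n ℚ.< ε)) →
      IsCauchy x
    oneSided x h ε 0<ε with h ε 0<ε
    ... | N , close = N , λ m n N≤m N≤n → ∣p∣<r (close m n N≤m N≤n)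
      (subst (ℚ._< ε) (solve 2 (λ a b → b :- a := :- (a :- b)) refl (x m) (x n))
        (close n m N≤n N≤m))

    bounded : ∀ x → IsCauchy x →
              ∃[ B ] (0ℚ ℚ.< B × Eventually λ n → ℚ.∣ x n ∣ ℚ.≤ B)
    bounded x cx with cx 1ℚ 0<1
    ... | N , close = B , 0<B , N , λ n N≤n → ℚₚ.≤-trans
        (ℚₚ.≤-reflexive (cong ℚ.∣_∣
          (solve 2 (λ a b → a := (a :- b) :+ b) refl (x n) (x N))))
        (ℚₚ.≤-trans (ℚₚ.∣p+q∣≤∣p∣+∣q∣ (x n ℚ.- x N) (x N))
          (ℚₚ.+-monoˡ-≤ ℚ.∣ x N ∣ (ℚₚ.<⇒≤ (close n N N≤n ℕₚ.≤-refl))))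
      where
      B : ℚ
      B = 1ℚ ℚ.+ ℚ.∣ x N ∣
      0<B : 0ℚ ℚ.< B
      0<B = ℚₚ.+-mono-<-≤ {0ℚ} {1ℚ} {0ℚ} 0<1 (ℚₚ.0≤∣p∣ (x N))

    const-cauchy : ∀ p → IsCauchy (λ _ → p)
    const-cauchy p ε 0<ε = 0 , λ _ _ _ _ →
      subst (ℚ._< ε) (sym (cong ℚ.∣_∣ (ℚₚ.+-inverseʳ p))) 0<ε

    +-cauchy : ∀ x y → IsCauchy x → IsCauchy y → IsCauchy (λ n → x n ℚ.+ y n)
    +-cauchy x y cx cy ε 0<ε with cx (½ ℚ.* ε) (0<½* 0<ε) | cy (½ ℚ.* ε) (0<½* 0<ε)
    ... | M , closeX | N , closeY = M ℕ.⊔ N , λ m n ≤m ≤n → ℚₚ.≤-<-trans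
      (ℚₚ.≤-trans
        (ℚₚ.≤-reflexive (cong ℚ.∣_∣
          (solve 4 (λ a b c d → (a :+ b) :- (c :+ d) := (a :- c) :+ (b :- d))
            refl (x m) (y m) (x n) (y n))))
        (ℚₚ.∣p+q∣≤∣p∣+∣q∣ (x m ℚ.- x n) (y m ℚ.- y n)))
      (subst (ℚ.∣ x m ℚ.- x n ∣ ℚ.+ ℚ.∣ y m ℚ.- y n ∣ ℚ.<_) (½+½ ε)
        (ℚₚ.+-mono-<
          (closeX m n (ℕₚ.m⊔n≤o⇒m≤o M N ≤m) (ℕₚ.m⊔n≤o⇒m≤o M N ≤n))
          (closeY m n (ℕₚ.m⊔n≤o⇒n≤o M N ≤m) (ℕₚ.m⊔n≤o⇒n≤o M N ≤n))))

    neg-cauchy : ∀ x → IsCauchy x → IsCauchy (λ n → ℚ.- x n)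
    neg-cauchy x cx ε 0<ε with cx ε 0<ε
    ... | N , close = N , λ m n N≤m N≤n → subst (ℚ._< ε)
      (trans (∣p-q∣≡∣q-p∣ (x m) (x n)) (cong ℚ.∣_∣
        (solve 2 (λ a b → b :- a := (:- a) :- (:- b)) refl (x m) (x n))))
      (close m n N≤m N≤n)

    *-small : ∀ p q {C γ} → 0ℚ ℚ.< C → ℚ.∣ p ∣ ℚ.≤ C → ℚ.∣ q ∣ ℚ.< γ →
              ℚ.∣ p ℚ.* q ∣ ℚ.< C ℚ.* γ
    *-small p q {C} {γ} 0<C ∣p∣≤C ∣q∣<γ = begin-strict
      ℚ.∣ p ℚ.* q ∣         ≡⟨ ℚₚ.∣p*q∣≡∣p∣*∣q∣ p q ⟩
      ℚ.∣ p ∣ ℚ.* ℚ.∣ q ∣   ≤⟨ *-mono-≤ (ℚₚ.<⇒≤ 0<C) (ℚₚ.0≤∣p∣ q) ∣p∣≤C ℚₚ.≤-refl ⟩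
      C ℚ.* ℚ.∣ q ∣         <⟨ ℚₚ.*-monoʳ-<-pos C {{ℚ.positive 0<C}} ∣q∣<γ ⟩
      C ℚ.* γ               ∎
      where open ℚₚ.≤-Reasoning

    *-close : ∀ a b c d {A B δ η ε} → 0ℚ ℚ.< A → 0ℚ ℚ.< B →
              A ℚ.* δ ≡ ½ ℚ.* ε → B ℚ.* η ≡ ½ ℚ.* ε →
              ℚ.∣ a ∣ ℚ.≤ A → ℚ.∣ d ∣ ℚ.≤ B →
              ℚ.∣ b ℚ.- d ∣ ℚ.< δ → ℚ.∣ a ℚ.- c ∣ ℚ.< η →
              ℚ.∣ a ℚ.* b ℚ.- c ℚ.* d ∣ ℚ.< ε
    *-close a b c d {A} {B} {δ} {η} {ε} 0<A 0<B Aδ≡ Bη≡ ∣a∣≤A ∣d∣≤B b≈d a≈c = begin-strict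
      ℚ.∣ a ℚ.* b ℚ.- c ℚ.* d ∣
        ≡⟨ cong ℚ.∣_∣ (solve 4 (λ a b c d →
             a :* b :- c :* d := a :* (b :- d) :+ d :* (a :- c)) refl a b c d) ⟩
      ℚ.∣ a ℚ.* (b ℚ.- d) ℚ.+ d ℚ.* (a ℚ.- c) ∣
        ≤⟨ ℚₚ.∣p+q∣≤∣p∣+∣q∣ (a ℚ.* (b ℚ.- d)) (d ℚ.* (a ℚ.- c)) ⟩
      ℚ.∣ a ℚ.* (b ℚ.- d) ∣ ℚ.+ ℚ.∣ d ℚ.* (a ℚ.- c) ∣
        <⟨ ℚₚ.+-mono-< (*-small a (b ℚ.- d) 0<A ∣a∣≤A b≈d)
                       (*-small d (a ℚ.- c) 0<B ∣d∣≤B a≈c) ⟩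
      A ℚ.* δ ℚ.+ B ℚ.* η
        ≡⟨ cong₂ ℚ._+_ Aδ≡ Bη≡ ⟩
      ½ ℚ.* ε ℚ.+ ½ ℚ.* ε
        ≡⟨ ½+½ ε ⟩
      ε ∎
      where open ℚₚ.≤-Reasoning

    *-cauchy : ∀ x y → IsCauchy x → IsCauchy y → IsCauchy (λ n → x n ℚ.* y n)
    *-cauchy x y cx cy ε 0<ε =
      let (A , 0<A , K , boundX) = bounded x cx
          (B , 0<B , L , boundY) = bounded y cy
          (δ , 0<δ , Aδ≡) = divide (½ ℚ.* ε) A (0<½* 0<ε) 0<A
          (η , 0<η , Bη≡) = divide (½ ℚ.* ε) B (0<½* 0<ε) 0<B
          (M , closeY) = cy δ 0<δ
          (N , closeX) = cx η 0<η
      in (K ℕ.⊔ L) ℕ.⊔ (M ℕ.⊔ N) , λ m n ≤m ≤n →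
      let K⊔L≤m = ℕₚ.m⊔n≤o⇒m≤o (K ℕ.⊔ L) (M ℕ.⊔ N) ≤m
          K⊔L≤n = ℕₚ.m⊔n≤o⇒m≤o (K ℕ.⊔ L) (M ℕ.⊔ N) ≤n
          M⊔N≤m = ℕₚ.m⊔n≤o⇒n≤o (K ℕ.⊔ L) (M ℕ.⊔ N) ≤m
          M⊔N≤n = ℕₚ.m⊔n≤o⇒n≤o (K ℕ.⊔ L) (M ℕ.⊔ N) ≤n
      in *-close (x m) (y m) (x n) (y n) 0<A 0<B Aδ≡ Bη≡
           (boundX m (ℕₚ.m⊔n≤o⇒m≤o K L K⊔L≤m)) (boundY n (ℕₚ.m⊔n≤o⇒n≤o K L K⊔L≤n))
           (closeY m n (ℕₚ.m⊔n≤o⇒m≤o M N M⊔N≤m) (ℕₚ.m⊔n≤o⇒m≤o M N M⊔N≤n))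
           (closeX m n (ℕₚ.m⊔n≤o⇒n≤o M N M⊔N≤m) (ℕₚ.m⊔n≤o⇒n≤o M N M⊔N≤n))

    ∣∣-cauchy : ∀ x → IsCauchy x → IsCauchy (λ n → ℚ.∣ x n ∣)
    ∣∣-cauchy x cx = oneSided (λ n → ℚ.∣ x n ∣) λ ε 0<ε → let (N , close) = cx ε 0<ε in
      N , λ m n N≤m N≤n → ℚₚ.≤-<-trans (reverse (x m) (x n)) (close m n N≤m N≤n)
      where
      reverse : ∀ p q → ℚ.∣ p ∣ ℚ.- ℚ.∣ q ∣ ℚ.≤ ℚ.∣ p ℚ.- q ∣
      reverse p q = subst (ℚ.∣ p ∣ ℚ.- ℚ.∣ q ∣ ℚ.≤_)
        (solve 2 (λ a b → (a :+ b) :- b := a) refl ℚ.∣ p ℚ.- q ∣ ℚ.∣ q ∣)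
        (ℚₚ.+-monoˡ-≤ (ℚ.- ℚ.∣ q ∣) (ℚₚ.≤-trans
          (ℚₚ.≤-reflexive (cong ℚ.∣_∣ (solve 2 (λ a b → a := (a :- b) :+ b) refl p q)))
          (ℚₚ.∣p+q∣≤∣p∣+∣q∣ (p ℚ.- q) q)))

open CauchyLemmas

infixl 6 _+_ _-_
infixl 7 _*_
infix  8 -_

fromℚ : ℚ → ℝ
fromℚ p = mkℝ (λ _ → p) (const-cauchy p)

fromℤ : ℤ → ℝ
fromℤ a = fromℚ (a ℚ./ 1)

fromℕ : ℕ → ℝ
fromℕ n = fromℤ (+ n)

0ℝ 1ℝ : ℝ
0ℝ = fromℕ 0
1ℝ = fromℕ 1

_+_ : ℝ → ℝ → ℝ
x + y = mkℝ (λ n → seq x n ℚ.+ seq y n) (+-cauchy (seq x) (seq y) (cauchy x) (cauchy y))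

_*_ : ℝ → ℝ → ℝ
x * y = mkℝ (λ n → seq x n ℚ.* seq y n) (*-cauchy (seq x) (seq y) (cauchy x) (cauchy y))

-_ : ℝ → ℝ
- x = mkℝ (λ n → ℚ.- seq x n) (neg-cauchy (seq x) (cauchy x))

_-_ : ℝ → ℝ → ℝ
x - y = x + (- y)

∣_∣ : ℝ → ℝ
∣ x ∣ = mkℝ (λ n → ℚ.∣ seq x n ∣) (∣∣-cauchy (seq x) (cauchy x))

sum : ∀ {n} → (Fin n → ℝ) → ℝ
sum = Vector.foldr _+_ 0ℝ

-- Bisection: for 0 ≤ q, the n-th step has located the square root of q in
-- the interval [ lower q n , lower q n + width q n ).
width : ℚ → ℕ → ℚ
width q zero    = 1ℚ ℚ.+ q
width q (suc n) = ½ ℚ.* width q n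

lower : ℚ → ℕ → ℚ
lower q zero    = 0ℚ
lower q (suc n) =
  let mid = lower q n ℚ.+ width q (suc n) in
  if ⌊ mid ℚ.* mid ℚₚ.≤? q ⌋ then mid else lower q n

module RootLemmas where
  open ℚ-Solver.+-*-Solver using (solve; _:+_; _:*_; _:-_; con; _:=_)

  width-nonNeg : ∀ {q} → 0ℚ ℚ.≤ q → ∀ n → 0ℚ ℚ.≤ width q n
  width-nonNeg 0≤q zero    = +-nonNeg (ℚₚ.<⇒≤ 0<1) 0≤q
  width-nonNeg 0≤q (suc n) = *-nonNeg (ℚₚ.<⇒≤ 0<½) (width-nonNeg 0≤q n)

  width-mono : ∀ {p q} → p ℚ.≤ q → ∀ n → width p n ℚ.≤ width q n
  width-mono p≤q zero    = ℚₚ.+-monoʳ-≤ 1ℚ p≤q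
  width-mono p≤q (suc n) = ℚₚ.*-monoˡ-≤-nonNeg ½ (width-mono p≤q n)

  width-decay : ∀ {q} → 0ℚ ℚ.≤ q → ∀ n → nat (suc n) ℚ.* width q n ℚ.≤ 1ℚ ℚ.+ q
  width-decay {q} 0≤q zero = ℚₚ.≤-reflexive
    (solve 1 (λ a → (con 1ℚ :+ con 0ℚ) :* (con 1ℚ :+ a) := con 1ℚ :+ a) refl q)
  width-decay {q} 0≤q (suc n) = ℚₚ.≤-trans (begin
    (1ℚ ℚ.+ (1ℚ ℚ.+ nat n)) ℚ.* (½ ℚ.* w)
      ≡⟨ solve 2 (λ k w → (con 1ℚ :+ (con 1ℚ :+ k)) :* (con ½ :* w)
           := w :+ con ½ :* (k :* w)) refl (nat n) w ⟩
    w ℚ.+ ½ ℚ.* (nat n ℚ.* w)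
      ≤⟨ ℚₚ.+-monoʳ-≤ w half≤ ⟩
    w ℚ.+ nat n ℚ.* w
      ≡⟨ solve 2 (λ k w → w :+ k :* w := (con 1ℚ :+ k) :* w) refl (nat n) w ⟩
    (1ℚ ℚ.+ nat n) ℚ.* w ∎)
    (width-decay 0≤q n)
    where
    open ℚₚ.≤-Reasoning
    w v : ℚ
    w = width q n
    v = nat n ℚ.* w
    0≤v : 0ℚ ℚ.≤ v
    0≤v = *-nonNeg (nat-mono {0} {n} ℕ.z≤n) (width-nonNeg 0≤q n)
    half≤ : ½ ℚ.* v ℚ.≤ v
    half≤ = subst₂ ℚ._≤_ (ℚₚ.+-identityʳ (½ ℚ.* v)) (½+½ v)
      (ℚₚ.+-monoʳ-≤ (½ ℚ.* v) (*-nonNeg (ℚₚ.<⇒≤ 0<½) 0≤v))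

  quotient-small : ∀ c k r ε w → 0ℚ ℚ.≤ k → 0ℚ ℚ.< ε →
                   k ℚ.* w ℚ.≤ c → ε ℚ.* r ≡ c → r ℚ.< k → w ℚ.< ε
  quotient-small c k r ε w 0≤k 0<ε kw≤c εr≡c r<k =
    ℚₚ.*-cancelˡ-<-nonNeg k {{ℚ.nonNegative 0≤k}} {w} {ε} (begin-strict
      k ℚ.* w  ≤⟨ kw≤c ⟩
      c        ≡⟨ εr≡c ⟨
      ε ℚ.* r  <⟨ ℚₚ.*-monoʳ-<-pos ε {{ℚ.positive 0<ε}} r<k ⟩
      ε ℚ.* k  ≡⟨ ℚₚ.*-comm ε k ⟩
      k ℚ.* ε  ∎)
    where open ℚₚ.≤-Reasoning

  nat-< : ∀ n → nat n ℚ.< nat (suc n)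
  nat-< n = subst (ℚ._< nat (suc n)) (ℚₚ.+-identityˡ (nat n))
    (ℚₚ.+-monoˡ-< (nat n) 0<1)

  width-null : ∀ q → 0ℚ ℚ.≤ q → ∀ ε → 0ℚ ℚ.< ε →
               Eventually λ n → width q n ℚ.< ε
  width-null q 0≤q ε 0<ε =
    let (r , _ , εr≡) = divide (1ℚ ℚ.+ q) ε (ℚₚ.+-mono-<-≤ {0ℚ} {1ℚ} {0ℚ} {q} 0<1 0≤q) 0<ε
        (N , r≤N) = archimedean r
    in N , λ n N≤n → quotient-small (1ℚ ℚ.+ q) (nat (suc n)) r ε (width q n)
      (nat-mono {0} {suc n} ℕ.z≤n) 0<ε (width-decay 0≤q n) εr≡
      (ℚₚ.≤-<-trans (ℚₚ.≤-trans r≤N (nat-mono N≤n)) (nat-< n))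

  lower-nonNeg : ∀ {q} → 0ℚ ℚ.≤ q → ∀ n → 0ℚ ℚ.≤ lower q n
  lower-nonNeg 0≤q zero = ℚₚ.≤-refl
  lower-nonNeg {q} 0≤q (suc n)
    with (lower q n ℚ.+ width q (suc n)) ℚ.* (lower q n ℚ.+ width q (suc n)) ℚₚ.≤? q
  ... | yes _ = +-nonNeg (lower-nonNeg 0≤q n) (width-nonNeg 0≤q (suc n))
  ... | no  _ = lower-nonNeg 0≤q n

  lower²≤ : ∀ {q} → 0ℚ ℚ.≤ q → ∀ n → lower q n ℚ.* lower q n ℚ.≤ q
  lower²≤ 0≤q zero = 0≤q
  lower²≤ {q} 0≤q (suc n)
    with (lower q n ℚ.+ width q (suc n)) ℚ.* (lower q n ℚ.+ width q (suc n)) ℚₚ.≤? q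
  ... | yes p = p
  ... | no  _ = lower²≤ 0≤q n

  <upper² : ∀ {q} → 0ℚ ℚ.≤ q → ∀ n →
    q ℚ.< (lower q n ℚ.+ width q n) ℚ.* (lower q n ℚ.+ width q n)
  <upper² {q} 0≤q zero = subst (q ℚ.<_)
    (solve 1 (λ a → con 1ℚ :+ (a :+ (a :+ a :* a))
       := (con 0ℚ :+ (con 1ℚ :+ a)) :* (con 0ℚ :+ (con 1ℚ :+ a))) refl q)
    (subst (ℚ._< 1ℚ ℚ.+ (q ℚ.+ (q ℚ.+ q ℚ.* q)))
      (solve 1 (λ a → con 0ℚ :+ (a :+ con 0ℚ) := a) refl q)
      (ℚₚ.+-mono-<-≤ 0<1 (ℚₚ.+-monoʳ-≤ q (+-nonNeg 0≤q (*-nonNeg 0≤q 0≤q)))))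
  <upper² {q} 0≤q (suc n)
    with (lower q n ℚ.+ width q (suc n)) ℚ.* (lower q n ℚ.+ width q (suc n)) ℚₚ.≤? q
  ... | no ¬p = ℚₚ.≰⇒> ¬p
  ... | yes _ = subst (q ℚ.<_)
    (solve 2 (λ l w → (l :+ w) :* (l :+ w)
       := (l :+ con ½ :* w :+ con ½ :* w) :* (l :+ con ½ :* w :+ con ½ :* w))
      refl (lower q n) (width q n))
    (<upper² 0≤q n)

  root-close : ∀ {a b s t w δ} → 0ℚ ℚ.≤ t → 0ℚ ℚ.≤ w → 0ℚ ℚ.< δ → w ℚ.< δ →
    s ℚ.* s ℚ.≤ a → b ℚ.< (t ℚ.+ w) ℚ.* (t ℚ.+ w) → a ℚ.- b ℚ.< δ ℚ.* δ →
    s ℚ.- t ℚ.< δ ℚ.+ δ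
  root-close {a} {b} {s} {t} {w} {δ} 0≤t 0≤w 0<δ w<δ s²≤a b<u² a-b<δ²
    with s ℚₚ.<? t ℚ.+ (δ ℚ.+ δ)
  ... | yes lt = p<q+r⇒p-q<r s t (δ ℚ.+ δ) lt
  ... | no ¬lt = contradiction (begin-strict
      a                                ≡⟨ solve 2 (λ a b → a := b :+ (a :- b)) refl a b ⟩
      b ℚ.+ (a ℚ.- b)                  <⟨ ℚₚ.+-mono-< b<u² a-b<δ² ⟩
      u ℚ.* u ℚ.+ δ ℚ.* δ              ≡⟨ ℚₚ.+-identityʳ _ ⟨
      u ℚ.* u ℚ.+ δ ℚ.* δ ℚ.+ 0ℚ       ≤⟨ ℚₚ.+-monoʳ-≤ (u ℚ.* u ℚ.+ δ ℚ.* δ) 0≤uδ+uδ ⟩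
      u ℚ.* u ℚ.+ δ ℚ.* δ ℚ.+ (u ℚ.* δ ℚ.+ u ℚ.* δ)
        ≡⟨ solve 2 (λ u d → u :* u :+ d :* d :+ (u :* d :+ u :* d)
             := (u :+ d) :* (u :+ d)) refl u δ ⟩
      (u ℚ.+ δ) ℚ.* (u ℚ.+ δ)          ≤⟨ *-mono-≤ (ℚₚ.≤-trans 0≤u+δ u+δ≤s) 0≤u+δ u+δ≤s u+δ≤s ⟩
      s ℚ.* s                          ≤⟨ s²≤a ⟩
      a                                ∎)
    (ℚₚ.<-irrefl refl)
    where
    open ℚₚ.≤-Reasoning
    u : ℚ
    u = t ℚ.+ w
    0≤δ : 0ℚ ℚ.≤ δ
    0≤δ = ℚₚ.<⇒≤ 0<δ
    0≤u : 0ℚ ℚ.≤ u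
    0≤u = +-nonNeg 0≤t 0≤w
    0≤u+δ : 0ℚ ℚ.≤ u ℚ.+ δ
    0≤u+δ = +-nonNeg 0≤u 0≤δ
    0≤uδ+uδ : 0ℚ ℚ.≤ u ℚ.* δ ℚ.+ u ℚ.* δ
    0≤uδ+uδ = +-nonNeg (*-nonNeg 0≤u 0≤δ) (*-nonNeg 0≤u 0≤δ)
    u+δ≤s : u ℚ.+ δ ℚ.≤ s
    u+δ≤s = ℚₚ.≤-trans (ℚₚ.≤-trans
      (ℚₚ.+-monoˡ-≤ δ (ℚₚ.+-monoʳ-≤ t (ℚₚ.<⇒≤ w<δ)))
      (ℚₚ.≤-reflexive (ℚₚ.+-assoc t δ δ))) (ℚₚ.≮⇒≥ ¬lt)

  0⊔-contract : ∀ p q → (0ℚ ℚ.⊔ p) ℚ.- (0ℚ ℚ.⊔ q) ℚ.≤ ℚ.∣ p ℚ.- q ∣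
  0⊔-contract p q = subst ((0ℚ ℚ.⊔ p) ℚ.- q⁺ ℚ.≤_)
    (solve 2 (λ a b → (a :+ b) :- a := b) refl q⁺ ℚ.∣ p ℚ.- q ∣)
    (ℚₚ.+-monoˡ-≤ (ℚ.- q⁺) (ℚₚ.⊔-lub
      (+-nonNeg (ℚₚ.p≤p⊔q 0ℚ q) (ℚₚ.0≤∣p∣ (p ℚ.- q)))
      (ℚₚ.≤-trans (ℚₚ.≤-reflexive (solve 2 (λ a b → a := b :+ (a :- b)) refl p q))
        (ℚₚ.+-mono-≤ (ℚₚ.p≤q⊔p 0ℚ q) (p≤∣p∣ (p ℚ.- q))))))
    where
    q⁺ : ℚ
    q⁺ = 0ℚ ℚ.⊔ q

  lower-close : ∀ a b m n {B δ} → 0ℚ ℚ.≤ a → 0ℚ ℚ.≤ b → b ℚ.≤ B → 0ℚ ℚ.< δ →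
                width B n ℚ.< δ → a ℚ.- b ℚ.< δ ℚ.* δ →
                lower a m ℚ.- lower b n ℚ.< δ ℚ.+ δ
  lower-close a b m n {B} {δ} 0≤a 0≤b b≤B 0<δ narrow a-b<δ² =
    root-close {a} {b} {lower a m} {lower b n} {width b n} {δ}
      (lower-nonNeg 0≤b n) (width-nonNeg 0≤b n) 0<δ
      (ℚₚ.≤-<-trans (width-mono b≤B n) narrow)
      (lower²≤ 0≤a m) (<upper² 0≤b n) a-b<δ²

  abstract
    √-cauchy : ∀ x → IsCauchy x → IsCauchy (λ n → lower (0ℚ ℚ.⊔ x n) n)
    √-cauchy x cx = oneSided (λ n → lower (0ℚ ℚ.⊔ x n) n) λ ε 0<ε →
      let δ = ½ ℚ.* ε
          0<δ = 0<½* 0<ε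
          (B , 0<B , K , bound) = bounded x cx
          (M , narrow) = width-null B (ℚₚ.<⇒≤ 0<B) δ 0<δ
          (N , close) = cx (δ ℚ.* δ) (*-pos 0<δ 0<δ)
      in K ℕ.⊔ (M ℕ.⊔ N) , λ m n ≤m ≤n →
      let K≤n   = ℕₚ.m⊔n≤o⇒m≤o K (M ℕ.⊔ N) ≤n
          M⊔N≤n = ℕₚ.m⊔n≤o⇒n≤o K (M ℕ.⊔ N) ≤n
          M⊔N≤m = ℕₚ.m⊔n≤o⇒n≤o K (M ℕ.⊔ N) ≤m
      in subst (lower (0ℚ ℚ.⊔ x m) m ℚ.- lower (0ℚ ℚ.⊔ x n) n ℚ.<_) (½+½ ε)
        (lower-close (0ℚ ℚ.⊔ x m) (0ℚ ℚ.⊔ x n) m n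
          (ℚₚ.p≤p⊔q 0ℚ (x m)) (ℚₚ.p≤p⊔q 0ℚ (x n))
          (ℚₚ.⊔-lub (ℚₚ.<⇒≤ 0<B) (ℚₚ.≤-trans (p≤∣p∣ (x n)) (bound n K≤n))) 0<δ
          (narrow n (ℕₚ.m⊔n≤o⇒m≤o M N M⊔N≤n))
          (ℚₚ.≤-<-trans (0⊔-contract (x m) (x n))
            (close m n (ℕₚ.m⊔n≤o⇒n≤o M N M⊔N≤m) (ℕₚ.m⊔n≤o⇒n≤o M N M⊔N≤n))))

open RootLemmas

infix 8 √_

-- The nonnegative square root; negative arguments are sent to 0.
√_ : ℝ → ℝ
√ x = mkℝ (λ n → lower (0ℚ ℚ.⊔ seq x n) n) (√-cauchy (seq x) (cauchy x))

infix 4 _≃ᶜ_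
infixl 6 _+ᶜ_ _-ᶜ_
infixl 7 _*ᶜ_ _·_

record ℂ : Set where
  constructor _+i_
  field
    re im : ℝ

open ℂ public

_≃ᶜ_ : ℂ → ℂ → Set
z ≃ᶜ w = re z ≃ re w × im z ≃ im w

_+ᶜ_ _-ᶜ_ _*ᶜ_ : ℂ → ℂ → ℂ
z +ᶜ w = (re z + re w) +i (im z + im w)
z -ᶜ w = (re z - re w) +i (im z - im w)
z *ᶜ w = (re z * re w - im z * im w) +i (re z * im w + im z * re w)

_·_ : ℝ → ℂ → ℂ
t · z = (t * re z) +i (t * im z)

∣_∣ᶜ : ℂ → ℝ
∣ z ∣ᶜ = √ (re z * re z + im z * im z)

fromℤᶜ : ℤ → ℂ
fromℤᶜ a = fromℤ a +i 0ℝ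

ω : ℂ
ω = (- fromℚ ½) +i (fromℚ ½ * √ fromℕ 3)

_∈ℤ[ω] : ℂ → Set
z ∈ℤ[ω] = ∃[ a ] ∃[ b ] z ≃ᶜ fromℤᶜ a +ᶜ fromℤᶜ b *ᶜ ω

next : ∀ {n} → Fin n → Fin n
next {suc n} i = suc (toℕ i) mod suc n

-- The point at parameter t on the i-th side of the closed polygonal line
-- through the given vertices.
sidePoint : ∀ {n} → (Fin n → ℂ) → Fin n → ℝ → ℂ
sidePoint v i t = v i +ᶜ t · (v (next i) -ᶜ v i)

-- The closed polygonal line does not meet itself: each of its points lies on
-- exactly one side, taken half-open, and for exactly one parameter.
IsSimple : ∀ {n} → (Fin n → ℂ) → Set
IsSimple v = ∀ i j s t → 0ℝ ≤ s → s < 1ℝ → 0ℝ ≤ t → t < 1ℝ →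
  sidePoint v i s ≃ᶜ sidePoint v j t → i ≡ j × s ≃ t

record Polygon : Set where
  field
    size   : ℕ
    3≤size : 3 ℕ.≤ size
    vertex : Fin size → ℂ
    simple : IsSimple vertex

  sideLength : Fin size → ℝ
  sideLength i = ∣ vertex (next i) -ᶜ vertex i ∣ᶜ

  perimeter : ℝ
  perimeter = sum sideLength

  -- The shoelace formula, which for a simple closed polygonal line gives the
  -- area of the region it encloses.
  area : ℝ
  area = ∣ fromℚ ½ * sum (λ i →
    re (vertex i) * im (vertex (next i)) - re (vertex (next i)) * im (vertex i)) ∣

  Equable : Set
  Equable = perimeter ≃ area

  HasVerticesInℤ[ω] : Set
  HasVerticesInℤ[ω] = ∀ i → vertex i ∈ℤ[ω]

{-# OPTIONS --safe #-}

-- With r = √3 the side lengths satisfy ℓᵢ² = Nᵢ for Eisenstein norms Nᵢ, and the area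
-- is an integer multiple of r / 4. So for an equable polygon the numbers 4 r ℓᵢ, square
-- roots of the integers 48 Nᵢ, have an integral sum s.
-- If nonnegative square roots x, y₁, …, yₙ of integers have an integral sum s, then x² is
-- a perfect square: the product p of the X - (± y₁ ± … ± yₙ) has integral coefficients, so
-- p (s - x) = A - x B and p (s + x) = A + x B with integers A and B. The former is 0, as
-- s - x = y₁ + … + yₙ, and the latter is positive if x > 0, as all its factors are. Hence
-- A² = x² B² with B ≠ 0.
-- Finally, if 48 N is a perfect square, then N = 3 k².

module Submission where

open import Defs
open import Algebra.Bundles using (CommutativeRing)
open import Data.Fin.Base using (Fin; zero; suc; punchIn)
open import Data.Integer.Base as ℤ using (ℤ)
import Data.Integer.Properties as ℤₚ
import Data.Integer.Solver as ℤ-Solver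
import Data.Nat.Base as ℕ
open ℕ using (ℕ; zero; suc)
open import Data.Nat.Primality using (euclidsLemma; prime?)
import Data.Nat.Properties as ℕₚ
open import Data.Nat.Coprimality as Coprimality using (Coprime; coprime-divisor; coprime-/gcd)
open import Data.Nat.Divisibility using (_∣_; divides; ∣-refl)
open import Data.Nat.DivMod using (m/n*n≡m)
open import Data.Nat.GCD using (gcd; gcd[m,n]≢0; gcd[m,n]∣m; gcd[m,n]∣n)
import Data.Nat.Solver as ℕ-Solver
open import Data.Product using (∃-syntax; _×_; _,_; proj₁; proj₂)
open import Data.Rational.Base as ℚ using (ℚ; 0ℚ; 1ℚ; ½)
import Data.Rational.Properties as ℚₚ
import Data.Rational.Solver as ℚ-Solver
import Data.Rational.Unnormalised.Base as ℚᵘ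
import Data.Rational.Unnormalised.Properties as ℚᵘₚ
open import Data.Sum.Base using (inj₁; inj₂; reduce)
open import Data.Vec.Functional using (tail; removeAt)
open import Level using (0ℓ)
open import Relation.Binary.PropositionalEquality as ≡
  using (_≡_; _≢_; refl; cong; cong₂; subst; subst₂)
import Relation.Binary.Reasoning.Setoid
open import Relation.Nullary using (¬_; yes; no; contradiction)
open import Relation.Nullary.Decidable using (from-yes)

open ℚ-Lemmas
open CauchyLemmas
open RootLemmas
open Polygon

open ℚ-Solver.+-*-Solver using (solve; _:+_; _:*_; _:-_; :-_; con; _:=_)

-- Eventual properties

both : ∀ {P Q : ℕ → Set} → Eventually P → Eventually Q → Eventually λ n → P n × Q n
both (M , p) (N , q) = M ℕ.⊔ N , λ n ≤n →
  p n (ℕₚ.m⊔n≤o⇒m≤o M N ≤n) , q n (ℕₚ.m⊔n≤o⇒n≤o M N ≤n)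

eventually-map : ∀ {P Q : ℕ → Set} → (∀ n → P n → Q n) → Eventually P → Eventually Q
eventually-map f (N , p) = N , λ n N≤n → f n (p n N≤n)

-- Equality of Cauchy sequences

pointwise : ∀ {x y} → (∀ n → seq x n ≡ seq y n) → x ≃ y
pointwise {x} {y} eq = mk≃ λ ε 0<ε → 0 , λ n _ → subst (ℚ._< ε)
  (≡.sym (≡.trans (cong (λ p → ℚ.∣ p ℚ.- seq y n ∣) (eq n)) (cong ℚ.∣_∣ (ℚₚ.+-inverseʳ (seq y n)))))
  0<ε

≃-refl : ∀ {x} → x ≃ x
≃-refl = pointwise λ _ → refl

≃-reflexive : ∀ {x y} → x ≡ y → x ≃ y
≃-reflexive refl = ≃-refl

≃-sym : ∀ {x y} → x ≃ y → y ≃ x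
≃-sym {x} {y} (mk≃ close) = mk≃ λ ε 0<ε →
  eventually-map (λ n → subst (ℚ._< ε) (∣p-q∣≡∣q-p∣ (seq x n) (seq y n))) (close ε 0<ε)

∣p+q∣<ε : ∀ p q r {ε} → r ≡ p ℚ.+ q → ℚ.∣ p ∣ ℚ.< ½ ℚ.* ε → ℚ.∣ q ∣ ℚ.< ½ ℚ.* ε → ℚ.∣ r ∣ ℚ.< ε
∣p+q∣<ε p q r {ε} refl p< q< = subst (ℚ.∣ p ℚ.+ q ∣ ℚ.<_) (½+½ ε)
  (ℚₚ.≤-<-trans (ℚₚ.∣p+q∣≤∣p∣+∣q∣ p q) (ℚₚ.+-mono-< p< q<))

≃-trans : ∀ {x y z} → x ≃ y → y ≃ z → x ≃ z
≃-trans {x} {y} {z} (mk≃ x≈y) (mk≃ y≈z) = mk≃ λ ε 0<ε → eventually-map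
  (λ n (p , q) → ∣p+q∣<ε (seq x n ℚ.- seq y n) (seq y n ℚ.- seq z n) _
    (solve 3 (λ a b c → a :- c := (a :- b) :+ (b :- c)) refl (seq x n) (seq y n) (seq z n)) p q)
  (both (x≈y (½ ℚ.* ε) (0<½* 0<ε)) (y≈z (½ ℚ.* ε) (0<½* 0<ε)))

+-cong : ∀ {x y u v} → x ≃ y → u ≃ v → x + u ≃ y + v
+-cong {x} {y} {u} {v} (mk≃ x≈y) (mk≃ u≈v) = mk≃ λ ε 0<ε → eventually-map
  (λ n (p , q) → ∣p+q∣<ε (seq x n ℚ.- seq y n) (seq u n ℚ.- seq v n) _
    (solve 4 (λ a b c d → (a :+ c) :- (b :+ d) := (a :- b) :+ (c :- d)) refl
      (seq x n) (seq y n) (seq u n) (seq v n)) p q)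
  (both (x≈y (½ ℚ.* ε) (0<½* 0<ε)) (u≈v (½ ℚ.* ε) (0<½* 0<ε)))

-- By `xu - yv = x (u - v) + v (x - y)`, eventual bounds on `x` and `v` control the error.
*-cong : ∀ {x y u v} → x ≃ y → u ≃ v → x * u ≃ y * v
*-cong {x} {y} {u} {v} (mk≃ x≈y) (mk≃ u≈v) = mk≃ λ ε 0<ε →
  let (A , 0<A , boundX) = bounded (seq x) (cauchy x)
      (B , 0<B , boundV) = bounded (seq v) (cauchy v)
      (δ , 0<δ , Aδ≡) = divide (½ ℚ.* ε) A (0<½* 0<ε) 0<A
      (η , 0<η , Bη≡) = divide (½ ℚ.* ε) B (0<½* 0<ε) 0<B
  in eventually-map
    (λ n ((∣x∣≤A , ∣v∣≤B) , (u≈v , x≈y)) →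
      *-close (seq x n) (seq u n) (seq y n) (seq v n) 0<A 0<B Aδ≡ Bη≡ ∣x∣≤A ∣v∣≤B u≈v x≈y)
    (both (both boundX boundV) (both (u≈v δ 0<δ) (x≈y η 0<η)))

-‿cong : ∀ {x y} → x ≃ y → - x ≃ - y
-‿cong {x} {y} (mk≃ close) = mk≃ λ ε 0<ε → eventually-map
  (λ n → subst (ℚ._< ε) (≡.trans (∣p-q∣≡∣q-p∣ (seq x n) (seq y n)) (cong ℚ.∣_∣
    (solve 2 (λ a b → b :- a := (:- a) :- (:- b)) refl (seq x n) (seq y n)))))
  (close ε 0<ε)

∣p∣-∣q∣≤∣p-q∣ : ∀ p q → ℚ.∣ p ∣ ℚ.- ℚ.∣ q ∣ ℚ.≤ ℚ.∣ p ℚ.- q ∣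
∣p∣-∣q∣≤∣p-q∣ p q = subst (ℚ.∣ p ∣ ℚ.- ℚ.∣ q ∣ ℚ.≤_)
  (solve 2 (λ a b → (a :+ b) :- b := a) refl ℚ.∣ p ℚ.- q ∣ ℚ.∣ q ∣)
  (ℚₚ.+-monoˡ-≤ (ℚ.- ℚ.∣ q ∣) (ℚₚ.≤-trans
    (ℚₚ.≤-reflexive (cong ℚ.∣_∣ (solve 2 (λ a b → a := (a :- b) :+ b) refl p q)))
    (ℚₚ.∣p+q∣≤∣p∣+∣q∣ (p ℚ.- q) q)))

∣∣-cong : ∀ {x y} → x ≃ y → ∣ x ∣ ≃ ∣ y ∣
∣∣-cong {x} {y} (mk≃ close) = mk≃ λ ε 0<ε → eventually-map
  (λ n p → ∣p∣<r
    (ℚₚ.≤-<-trans (∣p∣-∣q∣≤∣p-q∣ (seq x n) (seq y n)) p)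
    (ℚₚ.≤-<-trans
      (ℚₚ.≤-reflexive (solve 2 (λ a b → :- (a :- b) := b :- a) refl ℚ.∣ seq x n ∣ ℚ.∣ seq y n ∣))
      (ℚₚ.≤-<-trans (∣p∣-∣q∣≤∣p-q∣ (seq y n) (seq x n))
        (subst (ℚ._< ε) (∣p-q∣≡∣q-p∣ (seq x n) (seq y n)) p))))
  (close ε 0<ε)

-- The real numbers as a commutative ring

ℝ-commutativeRing : CommutativeRing 0ℓ 0ℓ
ℝ-commutativeRing = record
  { Carrier = ℝ ; _≈_ = _≃_ ; _+_ = _+_ ; _*_ = _*_ ; -_ = -_ ; 0# = 0ℝ ; 1# = 1ℝ
  ; isCommutativeRing = record
    { isRing = record
      { +-isAbelianGroup = record
        { isGroup = record
          { isMonoid = record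
            { isSemigroup = record
              { isMagma = record
                { isEquivalence = record { refl = ≃-refl ; sym = ≃-sym ; trans = ≃-trans }
                ; ∙-cong = +-cong }
              -- The operations are termwise, so each ring law is inherited from the rationals at
              -- every index; only the congruences need estimates.
              ; assoc = λ x y z → pointwise λ n → ℚₚ.+-assoc (seq x n) (seq y n) (seq z n) }
            ; identity = (λ x → pointwise λ n → ℚₚ.+-identityˡ (seq x n))
                       , (λ x → pointwise λ n → ℚₚ.+-identityʳ (seq x n)) }
          ; inverse = (λ x → pointwise λ n → ℚₚ.+-inverseˡ (seq x n))
                    , (λ x → pointwise λ n → ℚₚ.+-inverseʳ (seq x n))
          ; ⁻¹-cong = -‿cong }
        ; comm = λ x y → pointwise λ n → ℚₚ.+-comm (seq x n) (seq y n) }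
      ; *-cong = *-cong
      ; *-assoc = λ x y z → pointwise λ n → ℚₚ.*-assoc (seq x n) (seq y n) (seq z n)
      ; *-identity = (λ x → pointwise λ n → ℚₚ.*-identityˡ (seq x n))
                   , (λ x → pointwise λ n → ℚₚ.*-identityʳ (seq x n))
      ; distrib = (λ x y z → pointwise λ n → ℚₚ.*-distribˡ-+ (seq x n) (seq y n) (seq z n))
                , (λ x y z → pointwise λ n → ℚₚ.*-distribʳ-+ (seq x n) (seq y n) (seq z n)) }
    ; *-comm = λ x y → pointwise λ n → ℚₚ.*-comm (seq x n) (seq y n) } }

module ≃-Reasoning = Relation.Binary.Reasoning.Setoid (CommutativeRing.setoid ℝ-commutativeRing)
open import Algebra.Properties.Semiring.Sum (CommutativeRing.semiring ℝ-commutativeRing)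
  using (*-distribˡ-sum; sum-cong-≋)
open import Algebra.Properties.CommutativeMonoid.Sum
  (CommutativeRing.+-commutativeMonoid ℝ-commutativeRing) using (sum-remove)

-- Signs

-- Asked of every term, so this is stronger than `0ℝ ≤ x` and not invariant under `_≃_`. Square
-- roots, squares and natural numbers satisfy it by construction.
NonNeg : ℝ → Set
NonNeg x = ∀ n → 0ℚ ℚ.≤ seq x n

-- A positive rational witness below almost all terms, invariant under `_≃_`. Being a record, it
-- lets `x` be inferred from a proof.
record Positive (x : ℝ) : Set where
  constructor positive
  field
    ε    : ℚ
    0<ε  : 0ℚ ℚ.< ε
    ε≤x  : Eventually λ n → ε ℚ.≤ seq x n

-- Once the terms differ by less than `ε / 2`, those of `y` are at least `ε - ε / 2 = ε / 2`.
positive-resp-≃ : ∀ {x y} → x ≃ y → Positive x → Positive y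
positive-resp-≃ {x} {y} (mk≃ close) (positive ε 0<ε ε≤x) = positive (½ ℚ.* ε) (0<½* 0<ε) (eventually-map
  (λ n (ε≤x , x≈y) → subst₂ ℚ._≤_
    (≡.trans (cong (ℚ._- ½ ℚ.* ε) (≡.sym (½+½ ε)))
      (solve 1 (λ a → (a :+ a) :- a := a) refl (½ ℚ.* ε)))
    (solve 2 (λ a b → a :- (a :- b) := b) refl (seq x n) (seq y n))
    (ℚₚ.+-mono-≤ ε≤x (ℚₚ.neg-antimono-≤
      (ℚₚ.≤-trans (p≤∣p∣ (seq x n ℚ.- seq y n)) (ℚₚ.<⇒≤ x≈y)))))
  (both ε≤x (close (½ ℚ.* ε) (0<½* 0<ε))))

positive⇒≄0 : ∀ {x} → Positive x → ¬ x ≃ 0ℝ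
positive⇒≄0 {x} (positive ε 0<ε ε≤x) (mk≃ close) with both ε≤x (close ε 0<ε)
... | N , p = let (ε≤x , x<ε) = p N ℕₚ.≤-refl in
  ℚₚ.<-irrefl refl (ℚₚ.≤-<-trans ε≤x (ℚₚ.≤-<-trans
    (ℚₚ.≤-trans (ℚₚ.≤-reflexive (≡.sym (ℚₚ.+-identityʳ (seq x N)))) (p≤∣p∣ (seq x N ℚ.- 0ℚ))) x<ε))

positive-+-nonNeg : ∀ {x y} → Positive x → NonNeg y → Positive (x + y)
positive-+-nonNeg {x} {y} (positive ε 0<ε ε≤x) 0≤y = positive ε 0<ε (eventually-map
  (λ n ε≤x → subst (ℚ._≤ seq x n ℚ.+ seq y n) (ℚₚ.+-identityʳ ε) (ℚₚ.+-mono-≤ ε≤x (0≤y n))) ε≤x)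

positive-* : ∀ {x y} → Positive x → Positive y → Positive (x * y)
positive-* (positive ε 0<ε ε≤x) (positive δ 0<δ δ≤y) = positive (ε ℚ.* δ) (*-pos 0<ε 0<δ) (eventually-map
  (λ n (ε≤x , δ≤y) → *-mono-≤ (ℚₚ.≤-trans (ℚₚ.<⇒≤ 0<ε) ε≤x) (ℚₚ.<⇒≤ 0<δ) ε≤x δ≤y)
  (both ε≤x δ≤y))

-- If `B` eventually bounds `x`, then `ε ≤ x² ≤ B x`, so `x` stays above `δ = ε / B`.
square-positive⇒positive : ∀ {x} → NonNeg x → Positive (x * x) → Positive x
square-positive⇒positive {x} 0≤x (positive ε 0<ε ε≤x²) =
  let (B , 0<B , bound) = bounded (seq x) (cauchy x)
      (δ , 0<δ , Bδ≡ε) = divide ε B 0<ε 0<B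
  in positive δ 0<δ (eventually-map
    (λ n (ε≤x² , ∣x∣≤B) → ℚₚ.*-cancelˡ-≤-pos B {{ℚ.positive 0<B}} (ℚₚ.≤-trans
      (ℚₚ.≤-reflexive Bδ≡ε) (ℚₚ.≤-trans ε≤x²
        (ℚₚ.*-monoʳ-≤-nonNeg (seq x n) {{ℚ.nonNegative (0≤x n)}}
          (ℚₚ.≤-trans (p≤∣p∣ (seq x n)) ∣x∣≤B)))))
    (both ε≤x² bound))

-- For nonnegative `p` and `q`, `|p - q|² ≤ |p - q| (p + q) = |p² - q²|`. Squares within `ε²` of
-- each other thus have roots within `ε`.
square-injective : ∀ {x y} → NonNeg x → NonNeg y → x * x ≃ y * y → x ≃ y
square-injective {x} {y} 0≤x 0≤y (mk≃ close) = mk≃ λ ε 0<ε → eventually-map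
  (λ n → root (seq x n) (seq y n) (0≤x n) (0≤y n) 0<ε) (close (ε ℚ.* ε) (*-pos 0<ε 0<ε))
  where
  ∣p-q∣≤p+q : ∀ p q → 0ℚ ℚ.≤ p → 0ℚ ℚ.≤ q → ℚ.∣ p ℚ.- q ∣ ℚ.≤ p ℚ.+ q
  ∣p-q∣≤p+q p q 0≤p 0≤q = ℚₚ.≤-trans (ℚₚ.∣p+q∣≤∣p∣+∣q∣ p (ℚ.- q)) (ℚₚ.≤-reflexive
    (cong₂ ℚ._+_ (ℚₚ.0≤p⇒∣p∣≡p 0≤p) (≡.trans (ℚₚ.∣-p∣≡∣p∣ q) (ℚₚ.0≤p⇒∣p∣≡p 0≤q))))
  root : ∀ p q {ε} → 0ℚ ℚ.≤ p → 0ℚ ℚ.≤ q → 0ℚ ℚ.< ε →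
         ℚ.∣ p ℚ.* p ℚ.- q ℚ.* q ∣ ℚ.< ε ℚ.* ε → ℚ.∣ p ℚ.- q ∣ ℚ.< ε
  root p q {ε} 0≤p 0≤q 0<ε p²≈q² with ℚ.∣ p ℚ.- q ∣ ℚₚ.<? ε
  ... | yes lt = lt
  ... | no ¬lt = contradiction (begin-strict
      ε ℚ.* ε                             ≤⟨ *-mono-≤ (ℚₚ.0≤∣p∣ (p ℚ.- q)) (ℚₚ.<⇒≤ 0<ε) ε≤ ε≤ ⟩
      ℚ.∣ p ℚ.- q ∣ ℚ.* ℚ.∣ p ℚ.- q ∣     ≤⟨ ℚₚ.*-monoˡ-≤-nonNeg ℚ.∣ p ℚ.- q ∣ {{ℚ.nonNegative (ℚₚ.0≤∣p∣ (p ℚ.- q))}} (∣p-q∣≤p+q p q 0≤p 0≤q) ⟩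
      ℚ.∣ p ℚ.- q ∣ ℚ.* (p ℚ.+ q)         ≡⟨ cong (ℚ.∣ p ℚ.- q ∣ ℚ.*_) (ℚₚ.0≤p⇒∣p∣≡p (+-nonNeg 0≤p 0≤q)) ⟨
      ℚ.∣ p ℚ.- q ∣ ℚ.* ℚ.∣ p ℚ.+ q ∣     ≡⟨ ℚₚ.∣p*q∣≡∣p∣*∣q∣ (p ℚ.- q) (p ℚ.+ q) ⟨
      ℚ.∣ (p ℚ.- q) ℚ.* (p ℚ.+ q) ∣       ≡⟨ cong ℚ.∣_∣ (solve 2 (λ a b → (a :- b) :* (a :+ b) := a :* a :- b :* b) refl p q) ⟩
      ℚ.∣ p ℚ.* p ℚ.- q ℚ.* q ∣           <⟨ p²≈q² ⟩
      ε ℚ.* ε                             ∎)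
    (ℚₚ.<-irrefl refl)
    where
    open ℚₚ.≤-Reasoning
    ε≤ = ℚₚ.≮⇒≥ ¬lt

-- `square-injective` applies to `∣ x ∣` and `0ℝ`, which are nonnegative whatever the sign of `x`.
square≃0⇒≃0 : ∀ {x} → x * x ≃ 0ℝ → x ≃ 0ℝ
square≃0⇒≃0 {x} x²≃0 = mk≃ λ ε 0<ε → eventually-map
  (λ n → subst (ℚ._< ε) (≡.trans
    (cong ℚ.∣_∣ (ℚₚ.+-identityʳ ℚ.∣ seq x n ∣))
    (≡.trans (ℚₚ.∣∣p∣∣≡∣p∣ (seq x n)) (cong ℚ.∣_∣ (≡.sym (ℚₚ.+-identityʳ (seq x n)))))))
  (_≃_.close ∣x∣≃0 ε 0<ε)
  where
  ∣p∣²≡p² : ∀ p → ℚ.∣ p ∣ ℚ.* ℚ.∣ p ∣ ≡ p ℚ.* p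
  ∣p∣²≡p² p with ℚₚ.∣p∣≡p∨∣p∣≡-p p
  ... | inj₁ eq = cong₂ ℚ._*_ eq eq
  ... | inj₂ eq = ≡.trans (cong₂ ℚ._*_ eq eq) (solve 1 (λ a → :- a :* :- a := a :* a) refl p)
  ∣x∣≃0 : ∣ x ∣ ≃ 0ℝ
  ∣x∣≃0 = square-injective (λ n → ℚₚ.0≤∣p∣ (seq x n)) (λ _ → ℚₚ.≤-refl)
    (≃-trans (pointwise λ n → ∣p∣²≡p² (seq x n)) (≃-trans x²≃0 (pointwise λ _ → refl)))

nonNeg-summand≃0 : ∀ {x y} → NonNeg x → NonNeg y → x + y ≃ 0ℝ → x ≃ 0ℝ
nonNeg-summand≃0 {x} {y} 0≤x 0≤y (mk≃ close) = mk≃ λ ε 0<ε → eventually-map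
  (λ n → ℚₚ.≤-<-trans (small (seq x n) (seq y n) (0≤x n) (0≤y n))) (close ε 0<ε)
  where
  small : ∀ p q → 0ℚ ℚ.≤ p → 0ℚ ℚ.≤ q → ℚ.∣ p ℚ.- 0ℚ ∣ ℚ.≤ ℚ.∣ (p ℚ.+ q) ℚ.- 0ℚ ∣
  small p q 0≤p 0≤q = subst₂ ℚ._≤_
    (≡.trans (≡.sym (ℚₚ.0≤p⇒∣p∣≡p 0≤p)) (cong ℚ.∣_∣ (≡.sym (ℚₚ.+-identityʳ p))))
    (≡.trans (≡.sym (ℚₚ.0≤p⇒∣p∣≡p (+-nonNeg 0≤p 0≤q))) (cong ℚ.∣_∣ (≡.sym (ℚₚ.+-identityʳ (p ℚ.+ q)))))
    (subst (ℚ._≤ p ℚ.+ q) (ℚₚ.+-identityʳ p) (ℚₚ.+-monoʳ-≤ p 0≤q))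

nonNeg-* : ∀ {x y} → NonNeg x → NonNeg y → NonNeg (x * y)
nonNeg-* 0≤x 0≤y n = *-nonNeg (0≤x n) (0≤y n)

square-nonNeg : ∀ x → NonNeg (x * x)
square-nonNeg x n with ℚₚ.≤-total 0ℚ (seq x n)
... | inj₁ 0≤p = *-nonNeg 0≤p 0≤p
... | inj₂ p≤0 = subst (0ℚ ℚ.≤_) (solve 1 (λ a → :- a :* :- a := a :* a) refl (seq x n))
  (*-nonNeg (ℚₚ.neg-antimono-≤ p≤0) (ℚₚ.neg-antimono-≤ p≤0))

-- Square roots

√-nonNeg : ∀ x → NonNeg (√ x)
√-nonNeg x n = lower-nonNeg (ℚₚ.p≤p⊔q 0ℚ (seq x n)) n

-- Bisection keeps `l² ≤ q < (l + w)²`, so `q - l² < (w + 2l) w`. The first factor stays bounded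
-- while the width `w` tends to 0.
√-square : ∀ {x} → NonNeg x → √ x * √ x ≃ x
√-square {x} 0≤x = mk≃ λ ε 0<ε →
  let (A , 0<A , boundX) = bounded (seq x) (cauchy x)
      (B , 0<B , boundL) = bounded (seq (√ x)) (cauchy (√ x))
      -- `C` bounds `w + 2l` as soon as `w < 1` and `|l| ≤ B`.
      C = 1ℚ ℚ.+ (B ℚ.+ B)
      0<C = ℚₚ.+-mono-<-≤ 0<1 (+-nonNeg (ℚₚ.<⇒≤ 0<B) (ℚₚ.<⇒≤ 0<B))
      (δ , 0<δ , Cδ≡ε) = divide ε C 0<ε 0<C
      -- The width depends on the term `q`, which varies with `n`; monotonicity bounds it by the
      -- width for the constant `A`.
      narrow = width-null A (ℚₚ.<⇒≤ 0<A)
  in eventually-map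
    (λ n ((∣x∣≤A , ∣l∣≤B) , (w<1 , w<δ)) →
      let q = seq x n
          l = seq (√ x) n
          w = width q n
          0⊔q≡q = ℚₚ.p≤q⇒p⊔q≡q (0≤x n)
          w≤ = width-mono (ℚₚ.≤-trans (p≤∣p∣ q) ∣x∣≤A) n
      in sandwich {q} {l} {w} 0<C Cδ≡ε
           (subst (l ℚ.* l ℚ.≤_) 0⊔q≡q (lower²≤ (ℚₚ.p≤p⊔q 0ℚ q) n))
           -- The argument of `lower` is left as `0ℚ ℚ.⊔ q`, because that is what `l` unfolds to.
           (subst (λ p → p ℚ.< (lower (0ℚ ℚ.⊔ q) n ℚ.+ width p n) ℚ.* (lower (0ℚ ℚ.⊔ q) n ℚ.+ width p n))
             0⊔q≡q (<upper² (ℚₚ.p≤p⊔q 0ℚ q) n))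
           (width-nonNeg (0≤x n) n)
           (ℚₚ.≤-<-trans w≤ w<δ)
           (ℚₚ.+-mono-≤ (ℚₚ.≤-trans w≤ (ℚₚ.<⇒≤ w<1))
             (ℚₚ.+-mono-≤ (ℚₚ.≤-trans (p≤∣p∣ l) ∣l∣≤B) (ℚₚ.≤-trans (p≤∣p∣ l) ∣l∣≤B))))
    (both (both boundX boundL) (both (narrow 1ℚ 0<1) (narrow δ 0<δ)))
  where
  sandwich : ∀ {q l w C δ ε} → 0ℚ ℚ.< C → C ℚ.* δ ≡ ε → l ℚ.* l ℚ.≤ q →
             q ℚ.< (l ℚ.+ w) ℚ.* (l ℚ.+ w) → 0ℚ ℚ.≤ w → w ℚ.< δ → w ℚ.+ (l ℚ.+ l) ℚ.≤ C →
             ℚ.∣ l ℚ.* l ℚ.- q ∣ ℚ.< ε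
  sandwich {q} {l} {w} {C} {δ} {ε} 0<C Cδ≡ε l²≤q q<u² 0≤w w<δ w+2l≤C = ∣p∣<r
    (ℚₚ.≤-<-trans
      (ℚₚ.≤-trans (ℚₚ.+-monoˡ-≤ (ℚ.- q) l²≤q) (ℚₚ.≤-reflexive (ℚₚ.+-inverseʳ q)))
      (subst (0ℚ ℚ.<_) Cδ≡ε (*-pos 0<C (ℚₚ.≤-<-trans 0≤w w<δ))))
    (begin-strict
      ℚ.- (l ℚ.* l ℚ.- q)                         ≡⟨ solve 2 (λ a b → :- (a :- b) := b :- a) refl (l ℚ.* l) q ⟩
      q ℚ.- l ℚ.* l                               <⟨ ℚₚ.+-monoˡ-< (ℚ.- (l ℚ.* l)) q<u² ⟩
      (l ℚ.+ w) ℚ.* (l ℚ.+ w) ℚ.- l ℚ.* l         ≡⟨ solve 2 (λ l w → (l :+ w) :* (l :+ w) :- l :* l := (w :+ (l :+ l)) :* w) refl l w ⟩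
      (w ℚ.+ (l ℚ.+ l)) ℚ.* w                     ≤⟨ ℚₚ.*-monoʳ-≤-nonNeg w {{ℚ.nonNegative 0≤w}} w+2l≤C ⟩
      C ℚ.* w                                     <⟨ ℚₚ.*-monoʳ-<-pos C {{ℚ.positive 0<C}} w<δ ⟩
      C ℚ.* δ                                     ≡⟨ Cδ≡ε ⟩
      ε                                           ∎)
    where open ℚₚ.≤-Reasoning

-- Integers as real numbers

-- `a ℚ./ 1` is normalised by a gcd and does not compute for a variable `a`. Passing to unnormalised
-- rationals reduces the homomorphism laws to integer arithmetic.
toℚᵘ-/1 : ∀ a → ℚ.toℚᵘ (a ℚ./ 1) ℚᵘ.≃ ℚᵘ.mkℚᵘ a 0
toℚᵘ-/1 a = ℚₚ.toℚᵘ-fromℚᵘ (ℚᵘ.mkℚᵘ a 0)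

fromℤ-+ : ∀ a b → fromℤ (a ℤ.+ b) ≃ fromℤ a + fromℤ b
fromℤ-+ a b = pointwise λ _ → ℚₚ.toℚᵘ-injective (ℚᵘₚ.≃-trans (toℚᵘ-/1 (a ℤ.+ b))
  (ℚᵘₚ.≃-trans (ℚᵘ.*≡* (ℤS.solve 2 (λ a b → (a ℤS.:+ b) ℤS.:* ℤS.con ℤ.1ℤ
      ℤS.:= (a ℤS.:* ℤS.con ℤ.1ℤ ℤS.:+ b ℤS.:* ℤS.con ℤ.1ℤ) ℤS.:* ℤS.con ℤ.1ℤ) refl a b))
    (ℚᵘₚ.≃-sym (ℚᵘₚ.≃-trans (ℚₚ.toℚᵘ-homo-+ (a ℚ./ 1) (b ℚ./ 1))
      (ℚᵘₚ.+-cong (toℚᵘ-/1 a) (toℚᵘ-/1 b))))))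
  where module ℤS = ℤ-Solver.+-*-Solver

fromℤ-* : ∀ a b → fromℤ (a ℤ.* b) ≃ fromℤ a * fromℤ b
fromℤ-* a b = pointwise λ _ → ℚₚ.toℚᵘ-injective (ℚᵘₚ.≃-trans (toℚᵘ-/1 (a ℤ.* b))
  (ℚᵘₚ.≃-sym (ℚᵘₚ.≃-trans (ℚₚ.toℚᵘ-homo-* (a ℚ./ 1) (b ℚ./ 1))
    (ℚᵘₚ.*-cong (toℚᵘ-/1 a) (toℚᵘ-/1 b)))))

fromℤ-neg : ∀ a → fromℤ (ℤ.- a) ≃ - fromℤ a
fromℤ-neg a = pointwise λ _ → ℚₚ.toℚᵘ-injective (ℚᵘₚ.≃-trans (toℚᵘ-/1 (ℤ.- a))
  (ℚᵘₚ.≃-sym (ℚᵘₚ.≃-trans (ℚₚ.toℚᵘ-homo‿- (a ℚ./ 1)) (ℚᵘₚ.-‿cong (toℚᵘ-/1 a)))))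

fromℤ-- : ∀ a b → fromℤ (a ℤ.- b) ≃ fromℤ a - fromℤ b
fromℤ-- a b = ≃-trans (fromℤ-+ a (ℤ.- b)) (+-cong ≃-refl (fromℤ-neg b))

fromℕ-nonNeg : ∀ n → NonNeg (fromℕ n)
fromℕ-nonNeg n _ = ℚₚ.nonNegative⁻¹ _ {{ℚₚ.normalize-nonNeg n 1}}

fromℕ-positive : ∀ n → Positive (fromℕ (suc n))
fromℕ-positive n = positive _ (ℚₚ.positive⁻¹ _ {{ℚₚ.normalize-pos (suc n) 1}})
  (0 , λ _ _ → ℚₚ.≤-refl)

fromℤ≃0⇒≡0 : ∀ {a} → fromℤ a ≃ 0ℝ → a ≡ ℤ.0ℤ
fromℤ≃0⇒≡0 {ℤ.+ zero}    _   = refl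
fromℤ≃0⇒≡0 {ℤ.+ suc n}   a≃0 = contradiction a≃0 (positive⇒≄0 (fromℕ-positive n))
fromℤ≃0⇒≡0 {ℤ.-[1+ n ]}  a≃0 = contradiction
  (≃-trans (fromℤ-neg ℤ.-[1+ n ]) (≃-trans (-‿cong a≃0) (pointwise λ _ → refl)))
  (positive⇒≄0 (fromℕ-positive n))

fromℤ-injective : ∀ {a b} → fromℤ a ≃ fromℤ b → a ≡ b
fromℤ-injective {a} {b} a≃b = ℤₚ.i-j≡0⇒i≡j a b (fromℤ≃0⇒≡0 (begin
  fromℤ (a ℤ.- b)    ≈⟨ fromℤ-- a b ⟩
  fromℤ a - fromℤ b  ≈⟨ +-cong a≃b ≃-refl ⟩
  fromℤ b - fromℤ b  ≈⟨ CommutativeRing.-‿inverseʳ ℝ-commutativeRing (fromℤ b) ⟩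
  0ℝ                 ∎))
  where open ≃-Reasoning

-- For `a = -(n + 1)`, the number `fromℕ (suc n) + x` would be both positive and 0.
nonNeg≃fromℤ : ∀ {x a} → NonNeg x → x ≃ fromℤ a → a ≡ ℤ.+ ℤ.∣ a ∣
nonNeg≃fromℤ {a = ℤ.+ n} 0≤x x≃a = refl
nonNeg≃fromℤ {x} {ℤ.-[1+ n ]} 0≤x x≃a = contradiction
  (begin
    fromℕ (suc n) + x           ≈⟨ +-cong ≃-refl (≃-trans x≃a (fromℤ-neg (ℤ.+ suc n))) ⟩
    fromℕ (suc n) - fromℕ (suc n) ≈⟨ CommutativeRing.-‿inverseʳ ℝ-commutativeRing (fromℕ (suc n)) ⟩
    0ℝ ∎)
  (positive⇒≄0 (positive-+-nonNeg {fromℕ (suc n)} {x} (fromℕ-positive n) 0≤x))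
  where open ≃-Reasoning

-- Integral polynomials in one variable

infixl 6 _⊕_
infixl 7 _⊗_

-- Expressions instead of coefficient lists: polynomials are only evaluated and transformed by
-- recursion on their form, never compared.
data ℤ[X] : Set where
  X       : ℤ[X]
  const   : ℤ → ℤ[X]
  _⊕_ _⊗_ : ℤ[X] → ℤ[X] → ℤ[X]

⟦_⟧ : ℤ[X] → ℝ → ℝ
⟦ X ⟧       t = t
⟦ const a ⟧ t = fromℤ a
⟦ p ⊕ q ⟧   t = ⟦ p ⟧ t + ⟦ q ⟧ t
⟦ p ⊗ q ⟧   t = ⟦ p ⟧ t * ⟦ q ⟧ t

⟦_⟧ℤ : ℤ[X] → ℤ → ℤ
⟦ X ⟧ℤ       a = a
⟦ const b ⟧ℤ a = b
⟦ p ⊕ q ⟧ℤ   a = ⟦ p ⟧ℤ a ℤ.+ ⟦ q ⟧ℤ a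
⟦ p ⊗ q ⟧ℤ   a = ⟦ p ⟧ℤ a ℤ.* ⟦ q ⟧ℤ a

⟦⟧-cong : ∀ p {s t} → s ≃ t → ⟦ p ⟧ s ≃ ⟦ p ⟧ t
⟦⟧-cong X         s≃t = s≃t
⟦⟧-cong (const a) s≃t = ≃-refl
⟦⟧-cong (p ⊕ q)   s≃t = +-cong (⟦⟧-cong p s≃t) (⟦⟧-cong q s≃t)
⟦⟧-cong (p ⊗ q)   s≃t = *-cong (⟦⟧-cong p s≃t) (⟦⟧-cong q s≃t)

⟦⟧-fromℤ : ∀ p a → ⟦ p ⟧ (fromℤ a) ≃ fromℤ (⟦ p ⟧ℤ a)
⟦⟧-fromℤ X         a = ≃-refl
⟦⟧-fromℤ (const b) a = ≃-refl
⟦⟧-fromℤ (p ⊕ q)   a = ≃-trans (+-cong (⟦⟧-fromℤ p a) (⟦⟧-fromℤ q a)) (≃-sym (fromℤ-+ (⟦ p ⟧ℤ a) (⟦ q ⟧ℤ a)))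
⟦⟧-fromℤ (p ⊗ q)   a = ≃-trans (*-cong (⟦⟧-fromℤ p a) (⟦⟧-fromℤ q a)) (≃-sym (fromℤ-* (⟦ p ⟧ℤ a) (⟦ q ⟧ℤ a)))

-- p (t + y) = even c p (t) + y * odd c p (t) whenever y² = c.
even odd : ℤ → ℤ[X] → ℤ[X]
even c X         = X
even c (const a) = const a
even c (p ⊕ q)   = even c p ⊕ even c q
even c (p ⊗ q)   = even c p ⊗ even c q ⊕ const c ⊗ (odd c p ⊗ odd c q)
odd  c X         = const ℤ.1ℤ
odd  c (const a) = const ℤ.0ℤ
odd  c (p ⊕ q)   = odd c p ⊕ odd c q
odd  c (p ⊗ q)   = even c p ⊗ odd c q ⊕ odd c p ⊗ even c q

-- In a product, the term with both odd parts carries `y * y`, which becomes the integer `c` and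
-- joins the even part.
⟦⟧-shift : ∀ {c} p t {y} → y * y ≃ fromℤ c →
           ⟦ p ⟧ (t + y) ≃ ⟦ even c p ⟧ t + y * ⟦ odd c p ⟧ t
⟦⟧-shift X t {y} y²≃c = pointwise λ n →
  solve 2 (λ t y → t :+ y := t :+ y :* con 1ℚ) refl (seq t n) (seq y n)
⟦⟧-shift (const a) t {y} y²≃c = pointwise λ n →
  solve 2 (λ a y → a := a :+ y :* con 0ℚ) refl (a ℚ./ 1) (seq y n)
⟦⟧-shift {c} (p ⊕ q) t {y} y²≃c = ≃-trans
  (+-cong (⟦⟧-shift p t y²≃c) (⟦⟧-shift q t y²≃c))
  (pointwise λ n → solve 5 (λ y a b a′ b′ → (a :+ y :* b) :+ (a′ :+ y :* b′) := (a :+ a′) :+ y :* (b :+ b′))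
    refl (seq y n) (seq (⟦ even c p ⟧ t) n) (seq (⟦ odd c p ⟧ t) n)
    (seq (⟦ even c q ⟧ t) n) (seq (⟦ odd c q ⟧ t) n))
⟦⟧-shift {c} (p ⊗ q) t {y} y²≃c = begin
  ⟦ p ⟧ (t + y) * ⟦ q ⟧ (t + y)
    ≈⟨ *-cong (⟦⟧-shift p t y²≃c) (⟦⟧-shift q t y²≃c) ⟩
  (a + y * b) * (a′ + y * b′)
    ≈⟨ pointwise (λ n → solve 5 (λ y a b a′ b′ → (a :+ y :* b) :* (a′ :+ y :* b′)
         := (a :* a′ :+ y :* y :* (b :* b′)) :+ y :* (a :* b′ :+ b :* a′))
         refl (seq y n) (seq a n) (seq b n) (seq a′ n) (seq b′ n)) ⟩
  (a * a′ + y * y * (b * b′)) + y * (a * b′ + b * a′)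
    ≈⟨ +-cong (+-cong ≃-refl (*-cong y²≃c ≃-refl)) ≃-refl ⟩
  (a * a′ + fromℤ c * (b * b′)) + y * (a * b′ + b * a′) ∎
  where
  open ≃-Reasoning
  a a′ b b′ : ℝ
  a  = ⟦ even c p ⟧ t
  a′ = ⟦ even c q ⟧ t
  b  = ⟦ odd c p ⟧ t
  b′ = ⟦ odd c q ⟧ t

-- Products over conjugates

neg-square : ∀ {y z} → y * y ≃ z → (- y) * (- y) ≃ z
neg-square {y} = ≃-trans (pointwise λ n →
  solve 1 (λ y → :- y :* :- y := y :* y) refl (seq y n))

-- The norm `a² - c b²` of `a + b √c`, where `a` and `b` are the even and odd parts of `p`: an
-- integral polynomial for `p (X + √c) p (X - √c)`.
conjugateProduct : ℤ → ℤ[X] → ℤ[X]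
conjugateProduct c p = even c p ⊗ even c p ⊕ const (ℤ.- c) ⊗ (odd c p ⊗ odd c p)

⟦conjugateProduct⟧ : ∀ {c} p t {y} → y * y ≃ fromℤ c →
                     ⟦ conjugateProduct c p ⟧ t ≃ ⟦ p ⟧ (t + y) * ⟦ p ⟧ (t - y)
⟦conjugateProduct⟧ {c} p t {y} y²≃c = begin
  a * a + fromℤ (ℤ.- c) * (b * b)
    ≈⟨ +-cong ≃-refl (*-cong (≃-trans (fromℤ-neg c) (-‿cong (≃-sym y²≃c))) ≃-refl) ⟩
  a * a + (- (y * y)) * (b * b)
    ≈⟨ pointwise (λ n → solve 3 (λ y a b → a :* a :+ (:- (y :* y)) :* (b :* b)
         := (a :+ y :* b) :* (a :+ (:- y) :* b)) refl (seq y n) (seq a n) (seq b n)) ⟩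
  (a + y * b) * (a + (- y) * b)
    ≈⟨ *-cong (⟦⟧-shift p t y²≃c) (⟦⟧-shift p t (neg-square y²≃c)) ⟨
  ⟦ p ⟧ (t + y) * ⟦ p ⟧ (t - y) ∎
  where
  open ≃-Reasoning
  a b : ℝ
  a = ⟦ even c p ⟧ t
  b = ⟦ odd c p ⟧ t

-- The product of X - (± √ c₁ ± … ± √ cₙ) over all choices of signs.
signProduct : ∀ {n} → (Fin n → ℤ) → ℤ[X]
signProduct {zero}  c = X
signProduct {suc n} c = conjugateProduct (c zero) (signProduct (tail c))

-- The all-plus choice gives the vanishing factor: subtracting `y zero` from the sum leaves the sum
-- of the tail, a root by induction.
signProduct-root : ∀ {n} (c : Fin n → ℤ) (y : Fin n → ℝ) → (∀ i → y i * y i ≃ fromℤ (c i)) →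
                   ⟦ signProduct c ⟧ (sum y) ≃ 0ℝ
signProduct-root {zero}  c y y²≃c = ≃-refl
signProduct-root {suc n} c y y²≃c = begin
  ⟦ signProduct c ⟧ (sum y)
    ≈⟨ ⟦conjugateProduct⟧ p (sum y) (y²≃c zero) ⟩
  ⟦ p ⟧ (sum y + y zero) * ⟦ p ⟧ (sum y - y zero)
    ≈⟨ *-cong ≃-refl (⟦⟧-cong p (pointwise λ n →
         solve 2 (λ a b → (a :+ b) :- a := b) refl (seq (y zero) n) (seq (sum (tail y)) n))) ⟩
  ⟦ p ⟧ (sum y + y zero) * ⟦ p ⟧ (sum (tail y))
    ≈⟨ *-cong ≃-refl (signProduct-root (tail c) (tail y) (λ i → y²≃c (suc i))) ⟩
  ⟦ p ⟧ (sum y + y zero) * 0ℝ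
    ≈⟨ pointwise (λ n → ℚₚ.*-zeroʳ (seq (⟦ p ⟧ (sum y + y zero)) n)) ⟩
  0ℝ ∎
  where
  open ≃-Reasoning
  p : ℤ[X]
  p = signProduct (tail c)

-- Both `t + y zero` and `t - y zero` exceed the sum of the tail, the former by
-- `(t - sum y) + 2 y zero`. The induction therefore ranges over all `t`.
signProduct-positive : ∀ {n} (c : Fin n → ℤ) (y : Fin n → ℝ) → (∀ i → NonNeg (y i)) →
                       (∀ i → y i * y i ≃ fromℤ (c i)) →
                       ∀ t → Positive (t - sum y) → Positive (⟦ signProduct c ⟧ t)
signProduct-positive {zero} c y 0≤y y²≃c t t>Σ =
  positive-resp-≃ (pointwise λ n → ℚₚ.+-identityʳ (seq t n)) t>Σ
signProduct-positive {suc n} c y 0≤y y²≃c t t>Σ = positive-resp-≃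
  (≃-sym (⟦conjugateProduct⟧ p t (y²≃c zero)))
  (positive-*
    (ih (t + y zero) (positive-resp-≃
      (pointwise λ n → solve 3 (λ t a b → (t :- (a :+ b)) :+ (a :+ a) := (t :+ a) :- b) refl
        (seq t n) (seq (y zero) n) (seq (sum (tail y)) n))
      (positive-+-nonNeg {t - sum y} {y zero + y zero} t>Σ
        (λ n → +-nonNeg (0≤y zero n) (0≤y zero n)))))
    (ih (t - y zero) (positive-resp-≃
      (pointwise λ n → solve 3 (λ t a b → t :- (a :+ b) := (t :- a) :- b) refl
        (seq t n) (seq (y zero) n) (seq (sum (tail y)) n))
      t>Σ)))
  where
  p : ℤ[X]
  p = signProduct (tail c)
  ih : ∀ t → Positive (t - sum (tail y)) → Positive (⟦ p ⟧ t)
  ih = signProduct-positive (tail c) (tail y) (λ i → 0≤y (suc i)) (λ i → y²≃c (suc i))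

-- Rational square roots of natural numbers

-- In lowest terms `a′ / b′`, the denominator divides `a′²`. Being coprime to `a′`, it divides `a′`
-- and hence is 1.
square-quotient : ∀ a b d .{{_ : ℕ.NonZero b}} → a ℕ.* a ≡ d ℕ.* (b ℕ.* b) → ∃[ m ] d ≡ m ℕ.* m
square-quotient a b d a²≡db² = a′ , ≡.sym (≡.trans a′²≡db′² (≡.trans
  (cong (λ k → d ℕ.* (k ℕ.* k)) b′≡1) (ℕₚ.*-identityʳ d)))
  where
  g : ℕ
  g = gcd a b
  instance
    g≢0 : ℕ.NonZero g
    g≢0 = ℕ.≢-nonZero (gcd[m,n]≢0 a b (inj₂ (ℕ.≢-nonZero⁻¹ b)))
    g²≢0 : ℕ.NonZero (g ℕ.* g)
    g²≢0 = ℕₚ.m*n≢0 g g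
  a′ b′ : ℕ
  a′ = a ℕ./ g
  b′ = b ℕ./ g
  a≡ : a′ ℕ.* g ≡ a
  a≡ = m/n*n≡m (gcd[m,n]∣m a b)
  b≡ : b′ ℕ.* g ≡ b
  b≡ = m/n*n≡m (gcd[m,n]∣n a b)
  module ℕS = ℕ-Solver.+-*-Solver
  a′²≡db′² : a′ ℕ.* a′ ≡ d ℕ.* (b′ ℕ.* b′)
  a′²≡db′² = ℕₚ.*-cancelʳ-≡ _ _ (g ℕ.* g) (begin
    a′ ℕ.* a′ ℕ.* (g ℕ.* g)
      ≡⟨ ℕS.solve 2 (λ a g → a ℕS.:* a ℕS.:* (g ℕS.:* g) ℕS.:= (a ℕS.:* g) ℕS.:* (a ℕS.:* g)) refl a′ g ⟩
    (a′ ℕ.* g) ℕ.* (a′ ℕ.* g)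
      ≡⟨ cong₂ ℕ._*_ a≡ a≡ ⟩
    a ℕ.* a
      ≡⟨ a²≡db² ⟩
    d ℕ.* (b ℕ.* b)
      ≡⟨ cong (d ℕ.*_) (cong₂ ℕ._*_ b≡ b≡) ⟨
    d ℕ.* ((b′ ℕ.* g) ℕ.* (b′ ℕ.* g))
      ≡⟨ ℕS.solve 3 (λ d b g → d ℕS.:* ((b ℕS.:* g) ℕS.:* (b ℕS.:* g))
           ℕS.:= d ℕS.:* (b ℕS.:* b) ℕS.:* (g ℕS.:* g)) refl d b′ g ⟩
    d ℕ.* (b′ ℕ.* b′) ℕ.* (g ℕ.* g) ∎)
    where open ≡.≡-Reasoning
  coprime : Coprime a′ b′
  coprime = coprime-/gcd a b
  b′∣a′² : b′ ∣ a′ ℕ.* a′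
  b′∣a′² = divides (d ℕ.* b′) (≡.trans a′²≡db′² (≡.sym (ℕₚ.*-assoc d b′ b′)))
  b′≡1 : b′ ≡ 1
  b′≡1 = coprime (coprime-divisor (Coprimality.sym coprime) b′∣a′² , ∣-refl)

-- Square roots with an integral sum

-- The value `c i` is split by sign: 0 is a square, a negative value cannot be the square of a real
-- number, and a positive one is handled by conjugating the root `y i`.
roots-of-integral-sum : ∀ {n} (c : Fin n → ℤ) (y : Fin n → ℝ) → (∀ i → NonNeg (y i)) →
                        (∀ i → y i * y i ≃ fromℤ (c i)) → ∀ s → sum y ≃ fromℤ s →
                        ∀ i → ∃[ m ] ℤ.∣ c i ∣ ≡ m ℕ.* m
roots-of-integral-sum {suc n} c y 0≤y y²≃c s Σy≃s i with c i in cᵢ≡d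
... | ℤ.+ zero = 0 , refl
... | ℤ.-[1+ k ] = contradiction
        (nonNeg≃fromℤ {a = ℤ.-[1+ k ]} (square-nonNeg (y i)) (≃-trans (y²≃c i) (≃-reflexive (cong fromℤ cᵢ≡d))))
        λ ()
... | d@(ℤ.+ suc k) = result
  where
  open ≃-Reasoning
  x : ℝ
  x = y i
  z : Fin n → ℝ
  z = removeAt y i
  p : ℤ[X]
  p = signProduct (removeAt c i)
  A B : ℤ
  A = ⟦ even d p ⟧ℤ s
  B = ⟦ odd d p ⟧ℤ s
  x²≃d : x * x ≃ fromℤ d
  x²≃d = ≃-trans (y²≃c i) (≃-reflexive (cong fromℤ cᵢ≡d))
  s≃x+Σz : fromℤ s ≃ x + sum z
  s≃x+Σz = ≃-trans (≃-sym Σy≃s) (sum-remove {i = i} y)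
  -- Stated for any root `w` of `d`, to be used for both `x` and `- x` with the same integers `A`
  -- and `B`.
  p[s+] : ∀ {w} → w * w ≃ fromℤ d → ⟦ p ⟧ (fromℤ s + w) ≃ fromℤ A + w * fromℤ B
  p[s+] {w} w²≃d = ≃-trans (⟦⟧-shift p (fromℤ s) w²≃d)
    (+-cong (⟦⟧-fromℤ (even d p) s) (*-cong ≃-refl (⟦⟧-fromℤ (odd d p) s)))
  A-xB≃0 : fromℤ A + (- x) * fromℤ B ≃ 0ℝ
  A-xB≃0 = begin
    fromℤ A + (- x) * fromℤ B  ≈⟨ p[s+] (neg-square x²≃d) ⟨
    -- Removing `x` from the sum leaves the sum of the other roots, a zero of `p`.
    ⟦ p ⟧ (fromℤ s - x)        ≈⟨ ⟦⟧-cong p (≃-trans (+-cong s≃x+Σz ≃-refl) (pointwise λ n →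
                                    solve 2 (λ a b → (a :+ b) :- a := b) refl (seq x n) (seq (sum z) n))) ⟩
    ⟦ p ⟧ (sum z)              ≈⟨ signProduct-root (removeAt c i) z (λ j → y²≃c (punchIn i j)) ⟩
    0ℝ                         ∎
  x>0 : Positive x
  x>0 = square-positive⇒positive {x} (0≤y i) (positive-resp-≃ (≃-sym x²≃d) (fromℕ-positive k))
  A+xB>0 : Positive (fromℤ A + x * fromℤ B)
  A+xB>0 = positive-resp-≃ (p[s+] x²≃d)
    (signProduct-positive (removeAt c i) z (λ j → 0≤y (punchIn i j)) (λ j → y²≃c (punchIn i j))
      (fromℤ s + x) (positive-resp-≃ (begin
        -- The point `s + x` exceeds the sum of the other roots by `2x`, which is positive.
        x + x                    ≈⟨ pointwise (λ n → solve 2 (λ a b → a :+ a := ((a :+ b) :+ a) :- b) refl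
                                      (seq x n) (seq (sum z) n)) ⟩
        (x + sum z) + x - sum z  ≈⟨ +-cong (+-cong s≃x+Σz ≃-refl) ≃-refl ⟨
        fromℤ s + x - sum z      ∎)
        (positive-+-nonNeg {x} {x} x>0 (0≤y i))))
  A²≡dB² : A ℤ.* A ≡ d ℤ.* (B ℤ.* B)
  A²≡dB² = fromℤ-injective (begin
    fromℤ (A ℤ.* A)
      ≈⟨ fromℤ-* A A ⟩
    fromℤ A * fromℤ A
      -- `A² = (A - xB)(A + xB) + x² B²`, and the first factor is 0.
      ≈⟨ pointwise (λ n → solve 3 (λ x a b → a :* a
           := (a :+ :- x :* b) :* (a :+ x :* b) :+ x :* x :* (b :* b)) refl (seq x n) (A ℚ./ 1) (B ℚ./ 1)) ⟩
    (fromℤ A + (- x) * fromℤ B) * (fromℤ A + x * fromℤ B) + x * x * (fromℤ B * fromℤ B)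
      ≈⟨ +-cong (*-cong A-xB≃0 ≃-refl) (*-cong x²≃d (≃-sym (fromℤ-* B B))) ⟩
    0ℝ * (fromℤ A + x * fromℤ B) + fromℤ d * fromℤ (B ℤ.* B)
      ≈⟨ pointwise (λ n → solve 2 (λ u v → con 0ℚ :* u :+ v := v) refl
           (seq (fromℤ A + x * fromℤ B) n) (seq (fromℤ d * fromℤ (B ℤ.* B)) n)) ⟩
    fromℤ d * fromℤ (B ℤ.* B)
      ≈⟨ fromℤ-* d (B ℤ.* B) ⟨
    fromℤ (d ℤ.* (B ℤ.* B)) ∎)
  B≢0 : B ≢ ℤ.0ℤ
  -- With `B = 0`, the positive number `A + xB = (A - xB) + 2xB` would vanish.
  B≢0 B≡0 = positive⇒≄0 A+xB>0 (begin
    fromℤ A + x * fromℤ B            ≈⟨ pointwise (λ n → solve 3 (λ x a b → a :+ x :* b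
                                          := (a :+ :- x :* b) :+ (x :+ x) :* b) refl
                                          (seq x n) (A ℚ./ 1) (B ℚ./ 1)) ⟩
    (fromℤ A + (- x) * fromℤ B) + (x + x) * fromℤ B
                                     ≈⟨ +-cong A-xB≃0 (*-cong ≃-refl (≃-reflexive (cong fromℤ B≡0))) ⟩
    0ℝ + (x + x) * 0ℝ                ≈⟨ pointwise (λ n → solve 1 (λ x → con 0ℚ :+ (x :+ x) :* con 0ℚ
                                          := con 0ℚ) refl (seq x n)) ⟩
    0ℝ                               ∎)
  result : ∃[ m ] suc k ≡ m ℕ.* m
  -- Absolute values carry `A² = d B²` over to natural numbers.
  result = square-quotient ℤ.∣ A ∣ ℤ.∣ B ∣ (suc k)
    {{ℕ.≢-nonZero λ ∣B∣≡0 → B≢0 (ℤₚ.∣i∣≡0⇒i≡0 ∣B∣≡0)}}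
    (≡.trans (≡.sym (ℤₚ.abs-* A A)) (≡.trans (cong ℤ.∣_∣ A²≡dB²)
      (≡.trans (ℤₚ.abs-* d (B ℤ.* B)) (cong (suc k ℕ.*_) (ℤₚ.abs-* B B)))))

-- Polygons in the Eisenstein lattice

sum-fromℤ : ∀ {n} (a : Fin n → ℤ) → ∃[ s ] sum (λ i → fromℤ (a i)) ≃ fromℤ s
sum-fromℤ {zero}  a = ℤ.0ℤ , ≃-refl
sum-fromℤ {suc n} a = let (s , Σ≃s) = sum-fromℤ (tail a) in
  a zero ℤ.+ s , ≃-trans (+-cong ≃-refl Σ≃s) (≃-sym (fromℤ-+ (a zero) s))

nonNeg⇒∣x∣≃x : ∀ {x} → NonNeg x → ∣ x ∣ ≃ x
nonNeg⇒∣x∣≃x 0≤x = pointwise λ n → ℚₚ.0≤p⇒∣p∣≡p (0≤x n)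

∣fromℤ∣ : ∀ a → ∣ fromℤ a ∣ ≃ fromℕ ℤ.∣ a ∣
∣fromℤ∣ (ℤ.+ n)    = nonNeg⇒∣x∣≃x (fromℕ-nonNeg n)
∣fromℤ∣ ℤ.-[1+ n ] = ≃-trans (pointwise λ m → ℚₚ.∣-p∣≡∣p∣ (seq (fromℕ (suc n)) m))
  (nonNeg⇒∣x∣≃x (fromℕ-nonNeg (suc n)))

√3 : ℝ
√3 = √ fromℕ 3

√3-square : √3 * √3 ≃ fromℕ 3
√3-square = √-square (fromℕ-nonNeg 3)

-- This is `|a + b ω|²`, as `ω` and its conjugate have sum -1 and product 1.
eisensteinNorm : ℤ → ℤ → ℤ
eisensteinNorm a b = (a ℤ.* a ℤ.- a ℤ.* b) ℤ.+ b ℤ.* b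

fromℤ-eisensteinNorm : ∀ a b → fromℤ (eisensteinNorm a b) ≃
  (fromℤ a * fromℤ a - fromℤ a * fromℤ b) + fromℤ b * fromℤ b
fromℤ-eisensteinNorm a b = ≃-trans (fromℤ-+ (a ℤ.* a ℤ.- a ℤ.* b) (b ℤ.* b))
  (+-cong (≃-trans (fromℤ-- (a ℤ.* a) (a ℤ.* b)) (+-cong (fromℤ-* a a) (-‿cong (fromℤ-* a b))))
    (fromℤ-* b b))

-- As `48 = 4² · 3`, the number `3N` is the square of `m / 4`, hence of a natural number `l`. The
-- prime 3 divides `l`, and `l = 3k` gives `N = 3k²`.
3k²-from-square : ∀ N m → 48 ℕ.* N ≡ m ℕ.* m → ∃[ k ] N ≡ 3 ℕ.* (k ℕ.* k)
3k²-from-square N m 48N≡m² =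
  let (l , 3N≡l²) = square-quotient m 4 (3 ℕ.* N) (≡.trans (≡.sym 48N≡m²)
        (≡.trans (ℕₚ.*-assoc 16 3 N) (ℕₚ.*-comm 16 (3 ℕ.* N))))
      -- Both alternatives of Euclid's lemma say that 3 divides `l`; `reduce` merges them.
      divides k l≡3k = reduce (euclidsLemma l l (from-yes (prime? 3))
        (divides N (≡.trans (≡.sym 3N≡l²) (ℕₚ.*-comm 3 N))))
  in k , ℕₚ.*-cancelˡ-≡ N (3 ℕ.* (k ℕ.* k)) 3
    (≡.trans 3N≡l² (≡.trans (cong₂ ℕ._*_ l≡3k l≡3k) (rearrange k 3)))
  where
  module ℕS = ℕ-Solver.+-*-Solver
  rearrange : ∀ k t → (k ℕ.* t) ℕ.* (k ℕ.* t) ≡ t ℕ.* (t ℕ.* (k ℕ.* k))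
  rearrange = ℕS.solve 2 (λ k t → (k ℕS.:* t) ℕS.:* (k ℕS.:* t) ℕS.:= t ℕS.:* (t ℕS.:* (k ℕS.:* k))) refl

fromℚ-mono-≤ : ∀ {p q} → p ℚ.≤ q → fromℚ p ≤ fromℚ q
fromℚ-mono-≤ {p} {q} p≤q ε 0<ε = 0 , λ _ _ →
  subst (ℚ._< q ℚ.+ ε) (ℚₚ.+-identityʳ p) (ℚₚ.+-mono-≤-< p≤q 0<ε)

-- A degenerate side would take the same value at the parameters 0 and ½.
side-nondegenerate : ∀ P i → ¬ vertex P (next i) -ᶜ vertex P i ≃ᶜ 0ℝ +i 0ℝ
side-nondegenerate P i (re≃0 , im≃0) =
  contradiction (≃-sym (proj₂ (simple P i i 0ℝ (fromℚ ½)
    (fromℚ-mono-≤ {0ℚ} ℚₚ.≤-refl)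
    (½ , 0<½ , 0 , λ _ _ → from-yes (0ℚ ℚ.+ ½ ℚₚ.<? 1ℚ))
    (fromℚ-mono-≤ (ℚₚ.<⇒≤ 0<½))
    (½ ℚ.* ½ , 0<½* 0<½ , 0 , λ _ _ → from-yes (½ ℚ.+ ½ ℚ.* ½ ℚₚ.<? 1ℚ))
    (+-cong ≃-refl (parameter-irrelevant re≃0) , +-cong ≃-refl (parameter-irrelevant im≃0)))))
  (positive⇒≄0 (positive ½ 0<½ (0 , λ _ _ → ℚₚ.≤-refl)))
  where
  parameter-irrelevant : ∀ {s t x} → x ≃ 0ℝ → s * x ≃ t * x
  parameter-irrelevant {s} {t} {x} x≃0 = begin
    s * x   ≈⟨ *-cong ≃-refl x≃0 ⟩
    s * 0ℝ  ≈⟨ pointwise (λ n → ≡.trans (ℚₚ.*-zeroʳ (seq s n)) (≡.sym (ℚₚ.*-zeroʳ (seq t n)))) ⟩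
    t * 0ℝ  ≈⟨ *-cong ≃-refl x≃0 ⟨
    t * x   ∎
    where open ≃-Reasoning

-- Edges and their norms

module EisensteinPolygon (P : Polygon) (lattice : HasVerticesInℤ[ω] P) where
  open ≃-Reasoning

  a b : Fin (size P) → ℤ
  a i = proj₁ (lattice i)
  b i = proj₁ (proj₂ (lattice i))

  re≃ : ∀ i → re (vertex P i) ≃ fromℤ (a i) - fromℚ ½ * fromℤ (b i)
  re≃ i = ≃-trans (proj₁ (proj₂ (proj₂ (lattice i)))) (pointwise λ n →
    solve 3 (λ a b r → a :+ (b :* (:- con ½) :- con 0ℚ :* (con ½ :* r)) := a :- con ½ :* b) refl
      (a i ℚ./ 1) (b i ℚ./ 1) (seq √3 n))

  im≃ : ∀ i → im (vertex P i) ≃ fromℚ ½ * √3 * fromℤ (b i)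
  im≃ i = ≃-trans (proj₂ (proj₂ (proj₂ (lattice i)))) (pointwise λ n →
    solve 2 (λ b r → con 0ℚ :+ (b :* (con ½ :* r) :+ con 0ℚ :* (:- con ½)) := con ½ :* r :* b) refl
      (b i ℚ./ 1) (seq √3 n))

  norm : Fin (size P) → ℤ
  norm i = eisensteinNorm (a (next i) ℤ.- a i) (b (next i) ℤ.- b i)

  edge : Fin (size P) → ℂ
  edge i = vertex P (next i) -ᶜ vertex P i

  -- With `u + v ω` for the edge, `(u - v/2)² + 3 (v/2)² = u² - uv + v²`.
  ∣edge∣²≃norm : ∀ i → re (edge i) * re (edge i) + im (edge i) * im (edge i) ≃ fromℤ (norm i)
  ∣edge∣²≃norm i = begin
    re (edge i) * re (edge i) + im (edge i) * im (edge i)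
      ≈⟨ +-cong (*-cong re-edge re-edge) (*-cong im-edge im-edge) ⟩
    (u - fromℚ ½ * v) * (u - fromℚ ½ * v) + (fromℚ ½ * √3 * v) * (fromℚ ½ * √3 * v)
      -- The rational terms of `√3` do not square to 3, so `√3 * √3` is isolated here before
      -- `√3-square` replaces it.
      ≈⟨ pointwise (λ n → solve 3 (λ u v r →
           (u :- con ½ :* v) :* (u :- con ½ :* v) :+ (con ½ :* r :* v) :* (con ½ :* r :* v)
           := (u :- con ½ :* v) :* (u :- con ½ :* v) :+ r :* r :* (con ½ :* v :* (con ½ :* v)))
           refl (seq u n) (seq v n) (seq √3 n)) ⟩
    (u - fromℚ ½ * v) * (u - fromℚ ½ * v) + √3 * √3 * (fromℚ ½ * v * (fromℚ ½ * v))
      ≈⟨ +-cong ≃-refl (*-cong √3-square ≃-refl) ⟩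
    (u - fromℚ ½ * v) * (u - fromℚ ½ * v) + fromℕ 3 * (fromℚ ½ * v * (fromℚ ½ * v))
      ≈⟨ pointwise (λ n → solve 2 (λ u v →
           (u :- con ½ :* v) :* (u :- con ½ :* v) :+ con (ℤ.+ 3 ℚ./ 1) :* (con ½ :* v :* (con ½ :* v))
           := (u :* u :- u :* v) :+ v :* v) refl (seq u n) (seq v n)) ⟩
    (u * u - u * v) + v * v
      ≈⟨ fromℤ-eisensteinNorm (a (next i) ℤ.- a i) (b (next i) ℤ.- b i) ⟨
    fromℤ (norm i) ∎
    where
    u v : ℝ
    u = fromℤ (a (next i) ℤ.- a i)
    v = fromℤ (b (next i) ℤ.- b i)
    re-edge : re (edge i) ≃ u - fromℚ ½ * v
    re-edge = begin
      re (vertex P (next i)) - re (vertex P i)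
        ≈⟨ +-cong (re≃ (next i)) (-‿cong (re≃ i)) ⟩
      (fromℤ (a (next i)) - fromℚ ½ * fromℤ (b (next i))) - (fromℤ (a i) - fromℚ ½ * fromℤ (b i))
        ≈⟨ pointwise (λ n → solve 4 (λ a′ b′ a b → (a′ :- con ½ :* b′) :- (a :- con ½ :* b)
             := (a′ :- a) :- con ½ :* (b′ :- b)) refl
             (a (next i) ℚ./ 1) (b (next i) ℚ./ 1) (a i ℚ./ 1) (b i ℚ./ 1)) ⟩
      (fromℤ (a (next i)) - fromℤ (a i)) - fromℚ ½ * (fromℤ (b (next i)) - fromℤ (b i))
        ≈⟨ +-cong (fromℤ-- (a (next i)) (a i)) (-‿cong (*-cong ≃-refl (fromℤ-- (b (next i)) (b i)))) ⟨
      u - fromℚ ½ * v ∎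
    im-edge : im (edge i) ≃ fromℚ ½ * √3 * v
    im-edge = begin
      im (vertex P (next i)) - im (vertex P i)
        ≈⟨ +-cong (im≃ (next i)) (-‿cong (im≃ i)) ⟩
      fromℚ ½ * √3 * fromℤ (b (next i)) - fromℚ ½ * √3 * fromℤ (b i)
        ≈⟨ pointwise (λ n → solve 3 (λ r b′ b → con ½ :* r :* b′ :- con ½ :* r :* b
             := con ½ :* r :* (b′ :- b)) refl (seq √3 n) (b (next i) ℚ./ 1) (b i ℚ./ 1)) ⟩
      fromℚ ½ * √3 * (fromℤ (b (next i)) - fromℤ (b i))
        ≈⟨ *-cong ≃-refl (fromℤ-- (b (next i)) (b i)) ⟨
      fromℚ ½ * √3 * v ∎

  ∣edge∣²-nonNeg : ∀ i → NonNeg (re (edge i) * re (edge i) + im (edge i) * im (edge i))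
  ∣edge∣²-nonNeg i n = +-nonNeg (square-nonNeg (re (edge i)) n) (square-nonNeg (im (edge i)) n)

  sideLength-nonNeg : ∀ i → NonNeg (sideLength P i)
  sideLength-nonNeg i = √-nonNeg (re (edge i) * re (edge i) + im (edge i) * im (edge i))

  sideLength² : ∀ i → sideLength P i * sideLength P i ≃ fromℤ (norm i)
  sideLength² i = ≃-trans (√-square (∣edge∣²-nonNeg i)) (∣edge∣²≃norm i)

  norm≡∣norm∣ : ∀ i → norm i ≡ ℤ.+ ℤ.∣ norm i ∣
  norm≡∣norm∣ i = nonNeg≃fromℤ (∣edge∣²-nonNeg i) (∣edge∣²≃norm i)

  -- A vanishing sum of two squares forces both coordinates of the edge to be 0, which simplicity of
  -- the polygon excludes.
  norm≢0 : ∀ i → norm i ≢ ℤ.0ℤ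
  norm≢0 i norm≡0 = side-nondegenerate P i
    ( square≃0⇒≃0 (nonNeg-summand≃0 (square-nonNeg (re (edge i))) (square-nonNeg (im (edge i))) sum≃0)
    , square≃0⇒≃0 (nonNeg-summand≃0 (square-nonNeg (im (edge i))) (square-nonNeg (re (edge i)))
        (≃-trans (CommutativeRing.+-comm ℝ-commutativeRing
          (im (edge i) * im (edge i)) (re (edge i) * re (edge i))) sum≃0)))
    where
    sum≃0 : re (edge i) * re (edge i) + im (edge i) * im (edge i) ≃ 0ℝ
    sum≃0 = ≃-trans (∣edge∣²≃norm i) (≃-reflexive (cong fromℤ norm≡0))

  -- The area

  -- The determinant of consecutive vertices in the basis `1, ω`.
  cross : Fin (size P) → ℤ
  cross i = a i ℤ.* b (next i) ℤ.- a (next i) ℤ.* b i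

  crossSum : ℤ
  crossSum = proj₁ (sum-fromℤ cross)

  -- The factor `√3 / 2` is the determinant of the change of basis from `1, ω` to Cartesian
  -- coordinates.
  cross≃ : ∀ i → re (vertex P i) * im (vertex P (next i)) - re (vertex P (next i)) * im (vertex P i)
                 ≃ fromℚ ½ * √3 * fromℤ (cross i)
  cross≃ i = begin
    re (vertex P i) * im (vertex P (next i)) - re (vertex P (next i)) * im (vertex P i)
      ≈⟨ +-cong (*-cong (re≃ i) (im≃ (next i))) (-‿cong (*-cong (re≃ (next i)) (im≃ i))) ⟩
    (α - fromℚ ½ * β) * (fromℚ ½ * √3 * β′) - (α′ - fromℚ ½ * β′) * (fromℚ ½ * √3 * β)
      ≈⟨ pointwise (λ n → solve 5 (λ r a b a′ b′ →
           (a :- con ½ :* b) :* (con ½ :* r :* b′) :- (a′ :- con ½ :* b′) :* (con ½ :* r :* b)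
           := con ½ :* r :* (a :* b′ :- a′ :* b)) refl
           (seq √3 n) (seq α n) (seq β n) (seq α′ n) (seq β′ n)) ⟩
    fromℚ ½ * √3 * (α * β′ - α′ * β)
      ≈⟨ *-cong ≃-refl (≃-trans (fromℤ-- (a i ℤ.* b (next i)) (a (next i) ℤ.* b i))
           (+-cong (fromℤ-* (a i) (b (next i))) (-‿cong (fromℤ-* (a (next i)) (b i))))) ⟨
    fromℚ ½ * √3 * fromℤ (cross i) ∎
    where
    α β α′ β′ : ℝ
    α  = fromℤ (a i)
    β  = fromℤ (b i)
    α′ = fromℤ (a (next i))
    β′ = fromℤ (b (next i))

  -- The ½ of the shoelace formula meets the ½ of `cross≃`, and the nonnegative constant passes out
  -- of the absolute value.
  area≃ : area P ≃ fromℚ (½ ℚ.* ½) * √3 * fromℕ ℤ.∣ crossSum ∣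
  area≃ = begin
    area P
      ≈⟨ ∣∣-cong (*-cong ≃-refl (≃-trans (sum-cong-≋ cross≃) (≃-trans
           (≃-sym (*-distribˡ-sum (fromℚ ½ * √3) (λ i → fromℤ (cross i))))
           (*-cong ≃-refl (proj₂ (sum-fromℤ cross)))))) ⟩
    ∣ fromℚ ½ * (fromℚ ½ * √3 * fromℤ crossSum) ∣
      ≈⟨ ∣∣-cong (pointwise λ n → solve 2 (λ r d → con ½ :* (con ½ :* r :* d)
           := con (½ ℚ.* ½) :* r :* d) refl (seq √3 n) (crossSum ℚ./ 1)) ⟩
    ∣ q√3 * fromℤ crossSum ∣
      ≈⟨ pointwise (λ n → ℚₚ.∣p*q∣≡∣p∣*∣q∣ (seq q√3 n) (crossSum ℚ./ 1)) ⟩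
    ∣ q√3 ∣ * ∣ fromℤ crossSum ∣
      ≈⟨ *-cong (nonNeg⇒∣x∣≃x (nonNeg-* {fromℚ (½ ℚ.* ½)} {√3}
           (λ _ → ℚₚ.<⇒≤ (0<½* 0<½)) (√-nonNeg (fromℕ 3)))) (∣fromℤ∣ crossSum) ⟩
    q√3 * fromℕ ℤ.∣ crossSum ∣ ∎
    where
    q√3 : ℝ
    q√3 = fromℚ (½ ℚ.* ½) * √3

  -- Scaled by 4√3, the sides are square roots of integers, and an equable area is an integer.
  scaledSide : Fin (size P) → ℝ
  scaledSide i = fromℕ 4 * √3 * sideLength P i

  scaledSide-nonNeg : ∀ i → NonNeg (scaledSide i)
  scaledSide-nonNeg i = nonNeg-* {fromℕ 4 * √3} {sideLength P i}
    (nonNeg-* {fromℕ 4} {√3} (fromℕ-nonNeg 4) (√-nonNeg (fromℕ 3))) (sideLength-nonNeg i)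

  -- The factor 48 is `(4 √3)²`.
  scaledSide² : ∀ i → scaledSide i * scaledSide i ≃ fromℤ (ℤ.+ 48 ℤ.* norm i)
  scaledSide² i = begin
    scaledSide i * scaledSide i
      ≈⟨ pointwise (λ n → solve 2 (λ r l → (con (ℤ.+ 4 ℚ./ 1) :* r :* l) :* (con (ℤ.+ 4 ℚ./ 1) :* r :* l)
           := con (ℤ.+ 16 ℚ./ 1) :* (r :* r) :* (l :* l)) refl (seq √3 n) (seq (sideLength P i) n)) ⟩
    fromℕ 16 * (√3 * √3) * (sideLength P i * sideLength P i)
      ≈⟨ *-cong (*-cong ≃-refl √3-square) (sideLength² i) ⟩
    fromℕ 16 * fromℕ 3 * fromℤ (norm i)
      ≈⟨ *-cong (fromℤ-* (ℤ.+ 16) (ℤ.+ 3)) ≃-refl ⟨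
    fromℕ 48 * fromℤ (norm i)
      ≈⟨ fromℤ-* (ℤ.+ 48) (norm i) ⟨
    fromℤ (ℤ.+ 48 ℤ.* norm i) ∎

  -- Equability replaces the perimeter by the area, and `4 √3 · (√3 / 4) d = 3 d`.
  scaledSum : Equable P → sum scaledSide ≃ fromℤ (ℤ.+ 3 ℤ.* ℤ.+ ℤ.∣ crossSum ∣)
  scaledSum equable = begin
    sum scaledSide
      ≈⟨ *-distribˡ-sum (fromℕ 4 * √3) (sideLength P) ⟨
    fromℕ 4 * √3 * perimeter P
      ≈⟨ *-cong ≃-refl (≃-trans equable area≃) ⟩
    fromℕ 4 * √3 * (fromℚ (½ ℚ.* ½) * √3 * d)
      ≈⟨ pointwise (λ n → solve 2 (λ r d → con (ℤ.+ 4 ℚ./ 1) :* r :* (con (½ ℚ.* ½) :* r :* d)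
           := r :* r :* d) refl (seq √3 n) (seq d n)) ⟩
    √3 * √3 * d
      ≈⟨ *-cong √3-square ≃-refl ⟩
    fromℕ 3 * d
      ≈⟨ fromℤ-* (ℤ.+ 3) (ℤ.+ ℤ.∣ crossSum ∣) ⟨
    fromℤ (ℤ.+ 3 ℤ.* ℤ.+ ℤ.∣ crossSum ∣) ∎
    where
    d : ℝ
    d = fromℕ ℤ.∣ crossSum ∣

  -- Side lengths of an equable polygon

  norm≡3k² : Equable P → ∀ i → ∃[ k ] ℤ.∣ norm i ∣ ≡ 3 ℕ.* (k ℕ.* k)
  norm≡3k² equable i =
    let (m , ∣48N∣≡m²) = roots-of-integral-sum (λ j → ℤ.+ 48 ℤ.* norm j) scaledSide
          scaledSide-nonNeg scaledSide² (ℤ.+ 3 ℤ.* ℤ.+ ℤ.∣ crossSum ∣) (scaledSum equable) i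
    in 3k²-from-square ℤ.∣ norm i ∣ m (≡.trans (≡.sym (ℤₚ.abs-* (ℤ.+ 48) (norm i))) ∣48N∣≡m²)

  -- Both sides are nonnegative with square `3k²`.
  sideLength≃√3k : ∀ i k → ℤ.∣ norm i ∣ ≡ 3 ℕ.* (k ℕ.* k) → sideLength P i ≃ √3 * fromℕ k
  sideLength≃√3k i k ∣N∣≡3k² = square-injective (sideLength-nonNeg i)
    (nonNeg-* {√3} {fromℕ k} (√-nonNeg (fromℕ 3)) (fromℕ-nonNeg k)) (begin
      sideLength P i * sideLength P i   ≈⟨ sideLength² i ⟩
      fromℤ (norm i)                    ≡⟨ cong fromℤ (≡.trans (norm≡∣norm∣ i) (≡.trans (cong ℤ.+_ ∣N∣≡3k²)
                                             (≡.trans (ℤₚ.pos-* 3 (k ℕ.* k)) (cong (ℤ.+ 3 ℤ.*_) (ℤₚ.pos-* k k))))) ⟩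
      fromℤ (ℤ.+ 3 ℤ.* (ℤ.+ k ℤ.* ℤ.+ k))
                                        ≈⟨ ≃-trans (fromℤ-* (ℤ.+ 3) (ℤ.+ k ℤ.* ℤ.+ k))
                                             (*-cong (≃-sym √3-square) (fromℤ-* (ℤ.+ k) (ℤ.+ k))) ⟩
      √3 * √3 * (fromℕ k * fromℕ k)     ≈⟨ pointwise (λ n → solve 2 (λ r k → r :* r :* (k :* k)
                                             := (r :* k) :* (r :* k)) refl (seq √3 n) (seq (fromℕ k) n)) ⟩
      (√3 * fromℕ k) * (√3 * fromℕ k)   ∎)

  -- The multiple is positive because `k = 0` would give an edge of norm 0.
  positive-multiple : ∀ i → ∃[ k ] ℤ.∣ norm i ∣ ≡ 3 ℕ.* (k ℕ.* k) →
                      ∃[ n ] (0 ℕ.< n × sideLength P i ≃ √3 * fromℕ n)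
  positive-multiple i (zero  , N≡0)   = contradiction (ℤₚ.∣i∣≡0⇒i≡0 N≡0) (norm≢0 i)
  positive-multiple i (suc k , N≡3k²) = suc k , ℕ.s≤s ℕ.z≤n , sideLength≃√3k i (suc k) N≡3k²

lemma1 : (P : Polygon) → Equable P → HasVerticesInℤ[ω] P →
    ∀ i → ∃[ n ] (0 ℕ.< n × sideLength P i ≃ √ fromℕ 3 * fromℕ n)
lemma1 P equable lattice i = positive-multiple i (norm≡3k² equable i)
  where open EisensteinPolygon P lattice
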